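{- Let $n,m$ be non-negative integers and $p\geq 5$ a prime. Then \[ \nu_p\!\left(H(p^mn)-\frac{H(n)}{p^m}-\sum_{h=2}^{m-1}\sum_{k=1}^{h}\frac{B_{p^h(p-1)-2k}}{2k\,p^{h}}\binom{p^{h}(p-1)-1}{2k-1}p^{2k(m-h)}n^{2k}\right)\geq 1, \] where an empty sum is $0$.
   Context: For an integer $N\geq 0$, $H(N)=\sum_{i=1}^N\frac1i$ is the $N$-th harmonic number ($H(0)=0$). For a prime $p$ and rational $q$, $\nu_p(q)$ is the $p$-adic valuation ($\nu_p(0)=\infty$). $B_k$ is the $k$-th Bernoulli number, defined by $\frac{t}{e^t-1}=\sum_{k\geq 0}B_k\frac{t^k}{k!}$. -}

module Defs where

open import Data.Nat as ℕ using (ℕ; zero; suc; _∸_; _^_)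
open import Data.Nat.Divisibility using (_∣_)
open import Data.Nat.Combinatorics using (_C_)
open import Data.Integer as ℤ using (ℤ; +_; ∣_∣)
open import Data.Rational as ℚ using (ℚ; _/_; _+_; _*_; _-_; -_; ↥_; 0ℚ; 1ℚ)
open import Data.List using (List; []; _∷_; _++_; map; foldr; upTo; zipWith; length)

sumℚ : List ℚ → ℚ
sumℚ = foldr _+_ 0ℚ

-- Σ_{i=a}^{b} f i  (empty, i.e. 0, when b < a)
Σ[_⋯_] : ℕ → ℕ → (ℕ → ℚ) → ℚ
Σ[ a ⋯ b ] f = sumℚ (map (λ i → f (a ℕ.+ i)) (upTo (suc b ∸ a)))

ι : ℕ → ℚ
ι n = (+ n) / 1

-- q / d for a natural number d ≥ 1 (the value for d = 0 is never used)
_÷ℕ_ : ℚ → ℕ → ℚ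
q ÷ℕ zero = 0ℚ
q ÷ℕ suc d = q * ((+ 1) / suc d)

H : ℕ → ℚ
H N = Σ[ 1 ⋯ N ] (λ i → 1ℚ ÷ℕ i)

-- Bernoulli numbers B_0,…,B_{n-1} (as a list), via the standard recurrence
-- B_0 = 1,  B_n = -(1/(n+1)) Σ_{k=0}^{n-1} C(n+1,k) B_k,
-- which is equivalent to t/(e^t-1) = Σ B_k t^k/k!  (so B_1 = -1/2).
private
  nextB : ℕ → List ℚ → ℚ
  nextB n bs = - (sumℚ (zipWith (λ k b → ι (suc n C k) * b) (upTo n) bs) ÷ℕ suc n)

bernList : ℕ → List ℚ
bernList zero = []
bernList (suc zero) = 1ℚ ∷ []
bernList (suc n) = bernList n ++ (nextB n (bernList n) ∷ [])

private
  last : List ℚ → ℚ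
  last [] = 0ℚ
  last (x ∷ []) = x
  last (_ ∷ y ∷ ys) = last (y ∷ ys)

B : ℕ → ℚ
B n = last (bernList (suc n))

-- ν_p(q) ≥ 1 : p divides the numerator of q in lowest terms
-- (covers q = 0, where ν_p = ∞)
ν_≥1 : ℕ → ℚ → Set
ν p ≥1 q = p ∣ ∣ ↥ q ∣

{-# OPTIONS --safe #-}

-- With M = p^h (p ∸ 1), Euler's theorem gives 1/i ≡ i^(M-1) modulo p^(h+1) for i prime to p.
-- Hence H(px) - H(x)/p, the sum of 1/i over the i ≤ px prime to p, is congruent to the power sum
-- Σ_{i<px} i^(M-1), which Faulhaber's formula expands in Bernoulli numbers.  The odd Bernoulli
-- numbers vanish, and pB_j is p-integral, so modulo p^(h+1) only the terms (px)^(2k), 1 ≤ k ≤ h,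
-- survive.  Dividing by p^h and taking x = p^(m-1-h) n, the sum over h < m telescopes to
-- H(p^m n) - H(n)/p^m.  For h = 1 the remaining term is also divisible by p², because
-- B_{p(p-1)-2} is p-integral for p ≥ 5; this is Wolstenholme's theorem.
module Submission where

open import Defs
open import Data.Nat as ℕ using (ℕ; zero; suc; _≤_; _<_; _∸_; _^_; _!; z≤n; s≤s; NonZero)
import Data.Nat.Properties as ℕₚ
import Data.Nat.DivMod as ℕ/
open import Data.Nat.Divisibility
  using (_∣_; _∤_; divides; ∣⇒≤; ∣1⇒≡1; _∣?_; _∣0; m∣m*n; ∣m+n∣m⇒∣n)
open import Data.Nat.Primality using (Prime; euclidsLemma; prime⇒nonZero; prime⇒irreducible)
open import Data.Nat.Combinatorics
  using (_C_; nCn≡1; nC1≡n; nCk≡nC[n∸k]; nCk+nC[k+1]≡[n+1]C[k+1]; k>n⇒nCk≡0; nCk≡n!/k![n-k]!; k![n∸k]!∣n!)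
open import Data.Nat.Induction using (<-rec)
open import Data.Nat.Tactic.RingSolver using () renaming (solve-∀ to solve-∀ℕ)
open import Data.Integer as ℤ using (ℤ; ∣_∣)
import Data.Integer.Properties as ℤₚ
open import Data.Rational using (ℚ; mkℚ; 0ℚ; 1ℚ; _/_; toℚᵘ; ↥_; ↧ₙ_)
open import Data.Rational.Properties
open import Data.Rational.Unnormalised as ℚᵘ using (mkℚᵘ; *≡*)
import Data.Rational.Unnormalised.Properties as ℚᵘₚ
open import Data.List using (List; []; _∷_; _++_; applyUpTo; upTo; zipWith)
open import Data.List.Properties using (map-upTo; applyUpTo-∷ʳ)
open import Data.Product using (∃; _,_)
open import Data.Sum using (_⊎_; inj₁; inj₂; [_,_]′)
open import Function using (_∘_; id)
open import Relation.Binary.PropositionalEquality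
open import Relation.Nullary using (yes; no; contradiction)
open import Relation.Nullary.Decidable using (dec⇒maybe)
open import Tactic.RingSolver using (solve-∀)
open import Tactic.RingSolver.Core.AlmostCommutativeRing using (AlmostCommutativeRing; fromCommutativeRing)

-- All facts about Bernoulli numbers come from one identity of exponential generating functions,
-- B(t) e^(Nt) = B(t) + t (1 + e^t + ... + e^((N-1)t)). Its coefficients give Faulhaber's formula,
-- and the case N = 1 under t ↦ -t gives the vanishing at odd indices. Faulhaber's formula is then
-- also read backwards. Its term linear in N is N B_r, and the other terms involve smaller indices,
-- so it is a recursion for B_r in which N may be chosen. N = p gives the integrality of p B_r (a
-- weak form of von Staudt-Clausen) and p B_r ≡ Σ_{i<p} i^r modulo p. N = 1 gives the integrality of
-- B_r for r < p - 1. Both meet in B_{p(p-1)-2}: Fermat's theorem lowers the exponent of the power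
-- sum to p - 3, and that sum is p B_{p-3} ≡ 0 modulo p. The obstacle throughout is the denominator
-- k + 1 beside N^(k+1). One factor p of N^(k+1) makes the Bernoulli number integral, and the others
-- must absorb k + 1, for which 2n < p^n suffices.

module Bernoulli where
  open Data.Rational using (_+_; _*_; _-_; -_)
  open ≡-Reasoning

  -- Integers and reciprocals inside the rationals

  ℚ-ring : AlmostCommutativeRing _ _
  ℚ-ring = fromCommutativeRing +-*-commutativeRing λ x → dec⇒maybe (0ℚ ≟ x)

  +-interchange : ∀ a b c d → a + b + (c + d) ≡ a + c + (b + d)
  +-interchange = solve-∀ ℚ-ring

  *-interchange : ∀ a b c d → a * b * (c * d) ≡ a * c * (b * d)
  *-interchange = solve-∀ ℚ-ring

  ζ : ℤ → ℚ
  ζ z = z / 1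

  ζ-ᵘ : ∀ z → toℚᵘ (ζ z) ℚᵘ.≃ mkℚᵘ z 0
  ζ-ᵘ z = toℚᵘ-fromℚᵘ (mkℚᵘ z 0)

  ζ-+ : ∀ a b → ζ (a ℤ.+ b) ≡ ζ a + ζ b
  ζ-+ a b = toℚᵘ-injective (ℚᵘₚ.≃-trans (ζ-ᵘ (a ℤ.+ b))
    (ℚᵘₚ.≃-trans (*≡* (cong (ℤ._* (ℤ.+ 1)) (sym (cong₂ ℤ._+_ (ℤₚ.*-identityʳ a) (ℤₚ.*-identityʳ b)))))
    (ℚᵘₚ.≃-sym (ℚᵘₚ.≃-trans (toℚᵘ-homo-+ (ζ a) (ζ b)) (ℚᵘₚ.+-cong (ζ-ᵘ a) (ζ-ᵘ b))))))

  ζ-* : ∀ a b → ζ (a ℤ.* b) ≡ ζ a * ζ b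
  ζ-* a b = toℚᵘ-injective (ℚᵘₚ.≃-trans (ζ-ᵘ (a ℤ.* b))
    (ℚᵘₚ.≃-sym (ℚᵘₚ.≃-trans (toℚᵘ-homo-* (ζ a) (ζ b)) (ℚᵘₚ.*-cong (ζ-ᵘ a) (ζ-ᵘ b)))))

  ζ-neg : ∀ a → ζ (ℤ.- a) ≡ - ζ a
  ζ-neg a = toℚᵘ-injective (ℚᵘₚ.≃-trans (ζ-ᵘ (ℤ.- a))
    (ℚᵘₚ.≃-sym (ℚᵘₚ.≃-trans (toℚᵘ-homo‿- (ζ a)) (ℚᵘₚ.-‿cong (ζ-ᵘ a)))))

  ζ-injective : ∀ {a b} → ζ a ≡ ζ b → a ≡ b
  ζ-injective {a} {b} eq with fromℚᵘ-injective {mkℚᵘ a 0} {mkℚᵘ b 0} eq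
  ... | *≡* e = trans (sym (ℤₚ.*-identityʳ a)) (trans e (ℤₚ.*-identityʳ b))

  q*↧q≡↥q : ∀ q → q * ι (↧ₙ q) ≡ ζ (↥ q)
  q*↧q≡↥q q@(mkℚ n d _) = toℚᵘ-injective (ℚᵘₚ.≃-trans (toℚᵘ-homo-* q (ι (suc d)))
    (ℚᵘₚ.≃-trans (ℚᵘₚ.*-congˡ {toℚᵘ q} (ζ-ᵘ (ℤ.+ suc d)))
    (ℚᵘₚ.≃-trans (*≡* (trans (ℤₚ.*-identityʳ (n ℤ.* ℤ.+ suc d))
      (cong (λ x → n ℤ.* ℤ.+ suc x) (sym (ℕₚ.*-identityʳ d)))))
    (ℚᵘₚ.≃-sym (ζ-ᵘ n)))))

  ι-+ : ∀ m n → ι (m ℕ.+ n) ≡ ι m + ι n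
  ι-+ m n = ζ-+ (ℤ.+ m) (ℤ.+ n)

  ι-* : ∀ m n → ι (m ℕ.* n) ≡ ι m * ι n
  ι-* m n = trans (cong ζ (ℤₚ.pos-* m n)) (ζ-* (ℤ.+ m) (ℤ.+ n))

  ι-suc : ∀ n → ι (suc n) ≡ 1ℚ + ι n
  ι-suc = ι-+ 1

  ^-distribʳ-* : ∀ m n k → (m ℕ.* n) ^ k ≡ m ^ k ℕ.* n ^ k
  ^-distribʳ-* m n zero    = refl
  ^-distribʳ-* m n (suc k) = trans (cong (m ℕ.* n ℕ.*_) (^-distribʳ-* m n k))
    (ℕₚ.[m*n]*[o*p]≡[m*o]*[n*p] m n (m ^ k) (n ^ k))

  inv : ℕ → ℚ
  inv n = 1ℚ ÷ℕ n

  ι*inv : ∀ n .{{_ : NonZero n}} → ι n * inv n ≡ 1ℚ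
  ι*inv (suc d) = toℚᵘ-injective (ℚᵘₚ.≃-trans (toℚᵘ-homo-* (ι (suc d)) (inv (suc d)))
    (ℚᵘₚ.≃-trans (ℚᵘₚ.*-cong (ζ-ᵘ (ℤ.+ suc d))
       (ℚᵘₚ.≃-trans (toℚᵘ-cong (*-identityˡ ((ℤ.+ 1) / suc d))) (toℚᵘ-fromℚᵘ (mkℚᵘ (ℤ.+ 1) d))))
    (*≡* (trans (ℤₚ.*-identityʳ (ℤ.+ suc d ℤ.* ℤ.+ 1)) (trans (ℤₚ.*-identityʳ (ℤ.+ suc d))
      (cong (λ x → ℤ.+ suc x) (trans (sym (ℕₚ.+-identityʳ d)) (sym (ℕₚ.+-identityʳ (d ℕ.+ 0))))))))))

  -- At `n = 0` the default value of `÷ℕ` makes both sides 0.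
  ÷ℕ≡*inv : ∀ q n → q ÷ℕ n ≡ q * inv n
  ÷ℕ≡*inv q zero = sym (*-zeroʳ q)
  ÷ℕ≡*inv q (suc d) = cong (q *_) (sym (*-identityˡ ((ℤ.+ 1) / suc d)))

  *-cancel-ι : ∀ n .{{_ : NonZero n}} {q r} → ι n * q ≡ ι n * r → q ≡ r
  *-cancel-ι n {q} {r} eq = begin
    q                      ≡⟨ split q ⟩
    inv n * (ι n * q)      ≡⟨ cong (inv n *_) eq ⟩
    inv n * (ι n * r)      ≡⟨ split r ⟨
    r                      ∎
    where
    split : ∀ x → x ≡ inv n * (ι n * x)
    split x = begin
      x                    ≡⟨ *-identityˡ x ⟨
      1ℚ * x               ≡⟨ cong (_* x) (trans (sym (ι*inv n)) (*-comm (ι n) (inv n))) ⟩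
      inv n * ι n * x      ≡⟨ *-assoc (inv n) (ι n) x ⟩
      inv n * (ι n * x)    ∎

  inv-* : ∀ m n .{{_ : NonZero m}} .{{_ : NonZero n}} → inv (m ℕ.* n) ≡ inv m * inv n
  inv-* m n = *-cancel-ι (m ℕ.* n) {{ℕₚ.m*n≢0 m n}} (begin
    ι (m ℕ.* n) * inv (m ℕ.* n)       ≡⟨ ι*inv (m ℕ.* n) {{ℕₚ.m*n≢0 m n}} ⟩
    1ℚ * 1ℚ                           ≡⟨ cong₂ _*_ (ι*inv m) (ι*inv n) ⟨
    ι m * inv m * (ι n * inv n)       ≡⟨ *-interchange (ι m) (inv m) (ι n) (inv n) ⟩
    ι m * ι n * (inv m * inv n)       ≡⟨ cong (_* (inv m * inv n)) (ι-* m n) ⟨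
    ι (m ℕ.* n) * (inv m * inv n)     ∎)

  -- Finite sums

  Sum : ℕ → (ℕ → ℚ) → ℚ
  Sum zero    f = 0ℚ
  Sum (suc n) f = f 0 + Sum n (f ∘ suc)

  sumℚ-applyUpTo : ∀ f n → sumℚ (applyUpTo f n) ≡ Sum n f
  sumℚ-applyUpTo f zero    = refl
  sumℚ-applyUpTo f (suc n) = cong (f 0 +_) (sumℚ-applyUpTo (f ∘ suc) n)

  Σ≡Sum : ∀ a b f → Σ[ a ⋯ b ] f ≡ Sum (suc b ∸ a) (λ i → f (a ℕ.+ i))
  Σ≡Sum a b f = trans (cong sumℚ (map-upTo g n)) (sumℚ-applyUpTo g n)
    where
    n = suc b ∸ a
    g = λ i → f (a ℕ.+ i)

  Sum-cong : ∀ n {f g} → (∀ i → i < n → f i ≡ g i) → Sum n f ≡ Sum n g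
  Sum-cong zero    eq = refl
  Sum-cong (suc n) eq = cong₂ _+_ (eq 0 (s≤s z≤n)) (Sum-cong n λ i i<n → eq (suc i) (s≤s i<n))

  Sum-split : ∀ m n f → Sum (m ℕ.+ n) f ≡ Sum m f + Sum n (λ i → f (m ℕ.+ i))
  Sum-split zero    n f = sym (+-identityˡ _)
  Sum-split (suc m) n f = trans (cong (f 0 +_) (Sum-split m n (f ∘ suc))) (sym (+-assoc (f 0) _ _))

  Sum-suc : ∀ n f → Sum (suc n) f ≡ Sum n f + f n
  Sum-suc zero    f = +-comm (f 0) 0ℚ
  Sum-suc (suc n) f = trans (cong (f 0 +_) (Sum-suc n (f ∘ suc))) (sym (+-assoc (f 0) _ _))

  Sum-+ : ∀ n f g → Sum n (λ i → f i + g i) ≡ Sum n f + Sum n g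
  Sum-+ zero    f g = refl
  Sum-+ (suc n) f g = trans (cong ((f 0 + g 0) +_) (Sum-+ n (f ∘ suc) (g ∘ suc)))
    (+-interchange (f 0) (g 0) _ _)

  Sum-*ˡ : ∀ c n f → Sum n (λ i → c * f i) ≡ c * Sum n f
  Sum-*ˡ c zero    f = sym (*-zeroʳ c)
  Sum-*ˡ c (suc n) f = trans (cong (c * f 0 +_) (Sum-*ˡ c n (f ∘ suc))) (sym (*-distribˡ-+ c (f 0) _))

  -- Exponential generating functions

  Seq : Set
  Seq = ℕ → ℚ

  infixl 7 _⋆_ _·_
  infixl 6 _⊕_

  shift : Seq → Seq
  shift a n = a (suc n)

  _⊕_ : Seq → Seq → Seq
  (a ⊕ b) n = a n + b n

  _·_ : ℚ → Seq → Seq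
  (c · a) n = c * a n

  𝟘 : Seq
  𝟘 _ = 0ℚ

  𝟙 : Seq
  𝟙 zero    = 1ℚ
  𝟙 (suc _) = 0ℚ

  -- The Hurwitz product.  A sequence a stands for the series Σ a_n tⁿ/n!, so that shift is the
  -- derivative and the recursion is the Leibniz rule.
  _⋆_ : Seq → Seq → Seq
  (a ⋆ b) zero    = a 0 * b 0
  (a ⋆ b) (suc n) = (shift a ⋆ b) n + (a ⋆ shift b) n

  ⋆-cong : ∀ {a a′ b b′} → a ≗ a′ → b ≗ b′ → a ⋆ b ≗ a′ ⋆ b′
  ⋆-cong p q zero    = cong₂ _*_ (p 0) (q 0)
  ⋆-cong p q (suc n) = cong₂ _+_ (⋆-cong (p ∘ suc) q n) (⋆-cong p (q ∘ suc) n)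

  ⋆-comm : ∀ a b → a ⋆ b ≗ b ⋆ a
  ⋆-comm a b zero    = *-comm (a 0) (b 0)
  ⋆-comm a b (suc n) = trans (+-comm ((shift a ⋆ b) n) ((a ⋆ shift b) n))
    (cong₂ _+_ (⋆-comm a (shift b) n) (⋆-comm (shift a) b n))

  ⋆-distribʳ : ∀ c a b → (a ⊕ b) ⋆ c ≗ a ⋆ c ⊕ b ⋆ c
  ⋆-distribʳ c a b zero    = *-distribʳ-+ (c 0) (a 0) (b 0)
  ⋆-distribʳ c a b (suc n) = trans
    (cong₂ _+_ (⋆-distribʳ c (shift a) (shift b) n) (⋆-distribʳ (shift c) a b n))
    (+-interchange ((shift a ⋆ c) n) ((shift b ⋆ c) n) ((a ⋆ shift c) n) ((b ⋆ shift c) n))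

  ⋆-distribˡ : ∀ a b c → a ⋆ (b ⊕ c) ≗ a ⋆ b ⊕ a ⋆ c
  ⋆-distribˡ a b c n = trans (⋆-comm a (b ⊕ c) n) (trans (⋆-distribʳ a b c n)
    (cong₂ _+_ (⋆-comm b a n) (⋆-comm c a n)))

  ⋆-assoc : ∀ a b c → (a ⋆ b) ⋆ c ≗ a ⋆ (b ⋆ c)
  ⋆-assoc a b c zero    = *-assoc (a 0) (b 0) (c 0)
  ⋆-assoc a b c (suc n) = begin
    ((shift a ⋆ b ⊕ a ⋆ shift b) ⋆ c) n + (a ⋆ b ⋆ shift c) n
      ≡⟨ cong (_+ (a ⋆ b ⋆ shift c) n) (⋆-distribʳ c (shift a ⋆ b) (a ⋆ shift b) n) ⟩
    (shift a ⋆ b ⋆ c) n + (a ⋆ shift b ⋆ c) n + (a ⋆ b ⋆ shift c) n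
      ≡⟨ cong₂ _+_ (cong₂ _+_ (⋆-assoc (shift a) b c n) (⋆-assoc a (shift b) c n)) (⋆-assoc a b (shift c) n) ⟩
    (shift a ⋆ (b ⋆ c)) n + (a ⋆ (shift b ⋆ c)) n + (a ⋆ (b ⋆ shift c)) n
      ≡⟨ +-assoc ((shift a ⋆ (b ⋆ c)) n) ((a ⋆ (shift b ⋆ c)) n) ((a ⋆ (b ⋆ shift c)) n) ⟩
    (shift a ⋆ (b ⋆ c)) n + ((a ⋆ (shift b ⋆ c)) n + (a ⋆ (b ⋆ shift c)) n)
      ≡⟨ cong ((shift a ⋆ (b ⋆ c)) n +_) (⋆-distribˡ a (shift b ⋆ c) (b ⋆ shift c) n) ⟨
    (shift a ⋆ (b ⋆ c)) n + (a ⋆ (shift b ⋆ c ⊕ b ⋆ shift c)) n ∎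

  ⋆-·ˡ : ∀ c a b → (c · a) ⋆ b ≗ c · (a ⋆ b)
  ⋆-·ˡ c a b zero    = *-assoc c (a 0) (b 0)
  ⋆-·ˡ c a b (suc n) = trans (cong₂ _+_ (⋆-·ˡ c (shift a) b n) (⋆-·ˡ c a (shift b) n))
    (sym (*-distribˡ-+ c _ _))

  ⋆-·ʳ : ∀ c a b → a ⋆ (c · b) ≗ c · (a ⋆ b)
  ⋆-·ʳ c a b n = trans (⋆-comm a (c · b) n) (trans (⋆-·ˡ c b a n) (cong (c *_) (⋆-comm b a n)))

  ⋆-zeroˡ : ∀ a → 𝟘 ⋆ a ≗ 𝟘
  ⋆-zeroˡ a zero    = *-zeroˡ (a 0)
  ⋆-zeroˡ a (suc n) = trans (cong₂ _+_ (⋆-zeroˡ a n) (⋆-zeroˡ (shift a) n)) refl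

  ⋆-zeroʳ : ∀ a → a ⋆ 𝟘 ≗ 𝟘
  ⋆-zeroʳ a n = trans (⋆-comm a 𝟘 n) (⋆-zeroˡ a n)

  ⋆-identityˡ : ∀ a → 𝟙 ⋆ a ≗ a
  ⋆-identityˡ a zero    = *-identityˡ (a 0)
  ⋆-identityˡ a (suc n) = trans (cong₂ _+_ (⋆-zeroˡ a n) (⋆-identityˡ (shift a) n)) (+-identityˡ _)

  ⋆-identityʳ : ∀ a → a ⋆ 𝟙 ≗ a
  ⋆-identityʳ a n = trans (⋆-comm a 𝟙 n) (⋆-identityˡ a n)

  -- The Leibniz recursion is Pascal's rule: `shift a ⋆ b` supplies C(n,k) and `a ⋆ shift b`
  -- supplies C(n,k+1).
  ⋆-binomial : ∀ a b n → (a ⋆ b) n ≡ Sum (suc n) (λ k → ι (n C k) * (a k * b (n ∸ k)))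
  ⋆-binomial a b zero    = solve₁ (a 0 * b 0)
    where
    solve₁ : ∀ x → x ≡ 1ℚ * x + 0ℚ
    solve₁ = solve-∀ ℚ-ring
  ⋆-binomial a b (suc n) = begin
    (shift a ⋆ b) n + (a ⋆ shift b) n
      ≡⟨ cong₂ _+_ (⋆-binomial (shift a) b n) (⋆-binomial a (shift b) n) ⟩
    Sum (suc n) (λ k → ι (n C k) * t k) + (x + Sum n (λ k → ι (n C suc k) * (a (suc k) * b (suc (n ∸ suc k)))))
      ≡⟨ cong (λ y → Sum (suc n) (λ k → ι (n C k) * t k) + (x + y)) (Sum-cong n λ k k<n →
           cong (λ j → ι (n C suc k) * (a (suc k) * b j)) (sym (ℕₚ.+-∸-assoc 1 k<n))) ⟩
    Sum (suc n) (λ k → ι (n C k) * t k) + (x + Sum n (λ k → ι (n C suc k) * t k))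
      -- The two sums get equal length: the added top term carries C(n,n+1) = 0.
      ≡⟨ cong (λ y → Sum (suc n) (λ k → ι (n C k) * t k) + (x + y)) extend ⟩
    Sum (suc n) (λ k → ι (n C k) * t k) + (x + Sum (suc n) (λ k → ι (n C suc k) * t k))
      ≡⟨ rearrange (Sum (suc n) (λ k → ι (n C k) * t k)) x (Sum (suc n) (λ k → ι (n C suc k) * t k)) ⟩
    x + (Sum (suc n) (λ k → ι (n C k) * t k) + Sum (suc n) (λ k → ι (n C suc k) * t k))
      ≡⟨ cong (x +_) (Sum-+ (suc n) (λ k → ι (n C k) * t k) (λ k → ι (n C suc k) * t k)) ⟨
    x + Sum (suc n) (λ k → ι (n C k) * t k + ι (n C suc k) * t k)
      ≡⟨ cong (x +_) (Sum-cong (suc n) λ k _ → pascal k) ⟩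
    x + Sum (suc n) (λ k → ι (suc n C suc k) * t k) ∎
    where
    t : Seq
    t k = a (suc k) * b (n ∸ k)
    x = 1ℚ * (a 0 * b (suc n))
    rearrange : ∀ u v w → u + (v + w) ≡ v + (u + w)
    rearrange = solve-∀ ℚ-ring
    extend : Sum n (λ k → ι (n C suc k) * t k) ≡ Sum (suc n) (λ k → ι (n C suc k) * t k)
    extend = sym (begin
      Sum (suc n) (λ k → ι (n C suc k) * t k)
        ≡⟨ Sum-suc n (λ k → ι (n C suc k) * t k) ⟩
      Sum n (λ k → ι (n C suc k) * t k) + ι (n C suc n) * t n
        ≡⟨ cong (λ c → Sum n (λ k → ι (n C suc k) * t k) + ι c * t n) (k>n⇒nCk≡0 (ℕₚ.n<1+n n)) ⟩
      Sum n (λ k → ι (n C suc k) * t k) + 0ℚ * t n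
        ≡⟨ cong (Sum n (λ k → ι (n C suc k) * t k) +_) (*-zeroˡ (t n)) ⟩
      Sum n (λ k → ι (n C suc k) * t k) + 0ℚ                 ≡⟨ +-identityʳ _ ⟩
      Sum n (λ k → ι (n C suc k) * t k)                      ∎)
    pascal : ∀ k → ι (n C k) * t k + ι (n C suc k) * t k ≡ ι (suc n C suc k) * t k
    pascal k = begin
      ι (n C k) * t k + ι (n C suc k) * t k ≡⟨ *-distribʳ-+ (t k) (ι (n C k)) (ι (n C suc k)) ⟨
      (ι (n C k) + ι (n C suc k)) * t k     ≡⟨ cong (_* t k) (ι-+ (n C k) (n C suc k)) ⟨
      ι (n C k ℕ.+ n C suc k) * t k
        ≡⟨ cong (λ c → ι c * t k) (nCk+nC[k+1]≡[n+1]C[k+1] n k) ⟩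
      ι (suc n C suc k) * t k               ∎

  -- The series exp (x t).
  E : ℚ → Seq
  E x zero    = 1ℚ
  E x (suc n) = x * E x n

  E-ι : ∀ N n → E (ι N) n ≡ ι (N ^ n)
  E-ι N zero    = refl
  E-ι N (suc n) = trans (cong (ι N *_) (E-ι N n)) (sym (ι-* N (N ^ n)))

  -- Both sides have constant term 1 and solve a' = (x + y) a. Through `⋆-binomial` this is the
  -- binomial theorem, and `fermat` uses it as such.
  E-⋆ : ∀ x y → E x ⋆ E y ≗ E (x + y)
  E-⋆ x y zero    = refl
  E-⋆ x y (suc n) = begin
    ((x · E x) ⋆ E y) n + (E x ⋆ (y · E y)) n
      ≡⟨ cong₂ _+_ (⋆-·ˡ x (E x) (E y) n) (⋆-·ʳ y (E x) (E y) n) ⟩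
    x * (E x ⋆ E y) n + y * (E x ⋆ E y) n     ≡⟨ *-distribʳ-+ _ x y ⟨
    (x + y) * (E x ⋆ E y) n                   ≡⟨ cong ((x + y) *_) (E-⋆ x y n) ⟩
    (x + y) * E (x + y) n                     ∎

  E-1 : ∀ n → E 1ℚ n ≡ 1ℚ
  E-1 zero    = refl
  E-1 (suc n) = trans (*-identityˡ _) (E-1 n)

  E-0 : E 0ℚ ≗ 𝟙
  E-0 zero    = refl
  E-0 (suc n) = *-zeroˡ (E 0ℚ n)

  -- The series t.
  T : Seq
  T zero    = 0ℚ
  T (suc n) = 𝟙 n

  T⋆0 : ∀ a → (T ⋆ a) 0 ≡ 0ℚ
  T⋆0 a = *-zeroˡ (a 0)

  T⋆suc : ∀ a n → (T ⋆ a) (suc n) ≡ ι (suc n) * a n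
  T⋆suc a n = begin
    (𝟙 ⋆ a) n + (T ⋆ shift a) n     ≡⟨ cong₂ _+_ (⋆-identityˡ a n) (lemma n) ⟩
    a n + ι n * a n                 ≡⟨ collect (a n) (ι n) ⟩
    (1ℚ + ι n) * a n                ≡⟨ cong (_* a n) (ι-suc n) ⟨
    ι (suc n) * a n                 ∎
    where
    collect : ∀ x y → x + y * x ≡ (1ℚ + y) * x
    collect = solve-∀ ℚ-ring
    lemma : ∀ n → (T ⋆ shift a) n ≡ ι n * a n
    lemma zero    = trans (T⋆0 (shift a)) (sym (*-zeroˡ (a 0)))
    lemma (suc n) = T⋆suc (shift a) n

  -- Stands in for division by t: multiplication by t shifts the coefficients and scales them by
  -- nonzero factors.
  T⋆-cancel : ∀ {a b} → T ⋆ a ≗ T ⋆ b → a ≗ b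
  T⋆-cancel {a} {b} eq n = *-cancel-ι (suc n) (trans (sym (T⋆suc a n)) (trans (eq (suc n)) (T⋆suc b n)))

  -- The series (exp (N t) - 1) / t.
  A : ℕ → Seq
  A N k = ι (N ^ suc k) * inv (suc k)

  T⋆A : ∀ N → E (ι N) ≗ 𝟙 ⊕ T ⋆ A N
  T⋆A N zero    = sym (trans (cong (1ℚ +_) (T⋆0 (A N))) refl)
  T⋆A N (suc n) = begin
    E (ι N) (suc n)                          ≡⟨ E-ι N (suc n) ⟩
    ι (N ^ suc n)                            ≡⟨ *-identityʳ _ ⟨
    ι (N ^ suc n) * 1ℚ                       ≡⟨ cong (ι (N ^ suc n) *_) (ι*inv (suc n)) ⟨
    ι (N ^ suc n) * (ι (suc n) * inv (suc n)) ≡⟨ swap (ι (N ^ suc n)) (ι (suc n)) (inv (suc n)) ⟩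
    0ℚ + ι (suc n) * A N n                   ≡⟨ cong (0ℚ +_) (T⋆suc (A N) n) ⟨
    0ℚ + (T ⋆ A N) (suc n)                   ∎
    where
    swap : ∀ x y z → x * (y * z) ≡ 0ℚ + y * (x * z)
    swap = solve-∀ ℚ-ring

  -- The recurrence of the Bernoulli numbers

  -- The placeholder is resolved to the private function `last` of Defs, which cannot be named here.
  mutual
    lastℚ : List ℚ → ℚ
    lastℚ = _

    B≡last : ∀ n → B n ≡ lastℚ (bernList (suc n))
    B≡last n with bernList (suc n)
    ... | w = refl

  last-++ : ∀ xs y → lastℚ (xs ++ y ∷ []) ≡ y
  last-++ [] y = refl
  last-++ (x ∷ []) y = refl
  last-++ (x ∷ z ∷ xs) y = last-++ (z ∷ xs) y

  -- A copy of the private `nextB`, which unfolds to the same term.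
  nextBernoulli : ℕ → List ℚ → ℚ
  nextBernoulli n bs = - (sumℚ (zipWith (λ k b → ι (suc n C k) * b) (upTo n) bs) ÷ℕ suc n)

  B-suc : ∀ n → B (suc n) ≡ nextBernoulli (suc n) (bernList (suc n))
  B-suc n = trans (B≡last (suc n)) (last-++ (bernList (suc n)) _)

  bernList≡applyUpTo : ∀ n → bernList n ≡ applyUpTo B n
  bernList≡applyUpTo zero          = refl
  bernList≡applyUpTo (suc zero)    = refl
  bernList≡applyUpTo (suc (suc n)) = begin
    bernList (suc n) ++ nextBernoulli (suc n) (bernList (suc n)) ∷ []
      ≡⟨ cong₂ (λ xs y → xs ++ y ∷ []) (bernList≡applyUpTo (suc n)) (sym (B-suc n)) ⟩
    applyUpTo B (suc n) ++ B (suc n) ∷ []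
      ≡⟨ applyUpTo-∷ʳ B (suc n) ⟩
    applyUpTo B (suc (suc n)) ∎

  sumℚ-zipWith : ∀ (f : ℕ → ℚ → ℚ) g h n → sumℚ (zipWith f (applyUpTo g n) (applyUpTo h n))
    ≡ Sum n (λ k → f (g k) (h k))
  sumℚ-zipWith f g h zero    = refl
  sumℚ-zipWith f g h (suc n) = cong (f (g 0) (h 0) +_) (sumℚ-zipWith f (g ∘ suc) (h ∘ suc) n)

  [1+n]Cn≡1+n : ∀ n → suc n C n ≡ suc n
  [1+n]Cn≡1+n n = begin
    suc n C n             ≡⟨ nCk≡nC[n∸k] (ℕₚ.n≤1+n n) ⟩
    suc n C (suc n ∸ n)   ≡⟨ cong (suc n C_) (ℕₚ.m+n∸n≡m 1 n) ⟩
    suc n C 1             ≡⟨ nC1≡n (suc n) ⟩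
    suc n                 ∎

  -- The coefficients of B(t) (e^t - 1) = t. For m ≥ 2 the top coefficient C(m,m-1) = m cancels the
  -- division in the definition of B(m-1).
  B-recurrence : ∀ m → Sum m (λ k → ι (m C k) * B k) ≡ T m
  B-recurrence zero          = refl
  B-recurrence (suc zero)    = refl
  B-recurrence (suc (suc n)) = begin
    Sum (2 ℕ.+ n) f                                            ≡⟨ Sum-suc (suc n) f ⟩
    s + ι ((2 ℕ.+ n) C suc n) * B (suc n)
      ≡⟨ cong₂ (λ c x → s + ι c * x) ([1+n]Cn≡1+n (suc n)) B[1+n] ⟩
    s + ι (2 ℕ.+ n) * - (s * inv (2 ℕ.+ n))
      ≡⟨ factor s (ι (2 ℕ.+ n)) (inv (2 ℕ.+ n)) ⟩
    s * (1ℚ - ι (2 ℕ.+ n) * inv (2 ℕ.+ n))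
      ≡⟨ cong (λ x → s * (1ℚ - x)) (ι*inv (2 ℕ.+ n)) ⟩
    s * 0ℚ                                                     ≡⟨ *-zeroʳ s ⟩
    0ℚ                                                         ∎
    where
    f : Seq
    f k = ι ((2 ℕ.+ n) C k) * B k
    s = Sum (suc n) f
    factor : ∀ s x y → s + x * - (s * y) ≡ s * (1ℚ - x * y)
    factor = solve-∀ ℚ-ring
    B[1+n] : B (suc n) ≡ - (s * inv (2 ℕ.+ n))
    B[1+n] = begin
      B (suc n)                                        ≡⟨ B-suc n ⟩
      nextBernoulli (suc n) (bernList (suc n))
        ≡⟨ cong (nextBernoulli (suc n)) (bernList≡applyUpTo (suc n)) ⟩
      nextBernoulli (suc n) (applyUpTo B (suc n))
        ≡⟨ cong (λ x → - (x ÷ℕ (2 ℕ.+ n))) (sumℚ-zipWith (λ k b → ι ((2 ℕ.+ n) C k) * b) id B (suc n)) ⟩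
      - (s ÷ℕ (2 ℕ.+ n))                               ≡⟨ cong -_ (÷ℕ≡*inv s (2 ℕ.+ n)) ⟩
      - (s * inv (2 ℕ.+ n))                            ∎

  -- The term k = m missing from `B-recurrence` is B m itself; adding it turns e^t - 1 into e^t.
  B⋆E₁ : B ⋆ E 1ℚ ≗ B ⊕ T
  B⋆E₁ m = begin
    (B ⋆ E 1ℚ) m                                       ≡⟨ ⋆-binomial B (E 1ℚ) m ⟩
    Sum (suc m) (λ k → ι (m C k) * (B k * E 1ℚ (m ∸ k)))
      ≡⟨ Sum-cong (suc m) (λ k _ → cong (ι (m C k) *_)
        (trans (cong (B k *_) (E-1 (m ∸ k))) (*-identityʳ (B k)))) ⟩
    Sum (suc m) (λ k → ι (m C k) * B k)                ≡⟨ Sum-suc m (λ k → ι (m C k) * B k) ⟩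
    Sum m (λ k → ι (m C k) * B k) + ι (m C m) * B m
      ≡⟨ cong₂ (λ x c → x + ι c * B m) (B-recurrence m) (nCn≡1 m) ⟩
    T m + 1ℚ * B m                                     ≡⟨ cong (T m +_) (*-identityˡ (B m)) ⟩
    T m + B m                                          ≡⟨ +-comm (T m) (B m) ⟩
    B m + T m                                          ∎

  -- Power sums and Faulhaber's formula

  P : ℕ → Seq
  P N r = Sum N (λ i → ι (i ^ r))

  P-suc : ∀ N → P (suc N) ≗ P N ⊕ E (ι N)
  P-suc N r = trans (Sum-suc N (λ i → ι (i ^ r))) (cong (P N r +_) (sym (E-ι N r)))

  -- Multiplying B e^t = B + t by e^(Nt) produces t e^(Nt), the next summand of the power sum.
  B⋆E : ∀ N → B ⋆ E (ι N) ≗ B ⊕ T ⋆ P N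
  B⋆E zero n = begin
    (B ⋆ E 0ℚ) n       ≡⟨ ⋆-cong {B} (λ _ → refl) E-0 n ⟩
    (B ⋆ 𝟙) n          ≡⟨ ⋆-identityʳ B n ⟩
    B n                ≡⟨ +-identityʳ (B n) ⟨
    B n + 0ℚ           ≡⟨ cong (B n +_) (⋆-zeroʳ T n) ⟨
    B n + (T ⋆ 𝟘) n    ∎
  B⋆E (suc N) n = begin
    (B ⋆ E (ι (suc N))) n
      ≡⟨ ⋆-cong {B} (λ _ → refl) (λ k → cong (λ x → E x k) (ι-suc N)) n ⟩
    (B ⋆ E (1ℚ + ι N)) n               ≡⟨ ⋆-cong {B} (λ _ → refl) (λ k → E-⋆ 1ℚ (ι N) k) n ⟨
    (B ⋆ (E 1ℚ ⋆ E (ι N))) n           ≡⟨ ⋆-assoc B (E 1ℚ) (E (ι N)) n ⟨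
    (B ⋆ E 1ℚ ⋆ E (ι N)) n             ≡⟨ ⋆-cong {B ⋆ E 1ℚ} {b = E (ι N)} B⋆E₁ (λ _ → refl) n ⟩
    ((B ⊕ T) ⋆ E (ι N)) n              ≡⟨ ⋆-distribʳ (E (ι N)) B T n ⟩
    (B ⋆ E (ι N)) n + (T ⋆ E (ι N)) n  ≡⟨ cong (_+ (T ⋆ E (ι N)) n) (B⋆E N n) ⟩
    B n + (T ⋆ P N) n + (T ⋆ E (ι N)) n ≡⟨ +-assoc (B n) ((T ⋆ P N) n) ((T ⋆ E (ι N)) n) ⟩
    B n + ((T ⋆ P N) n + (T ⋆ E (ι N)) n) ≡⟨ cong (B n +_) (⋆-distribˡ T (P N) (E (ι N)) n) ⟨
    B n + (T ⋆ (P N ⊕ E (ι N))) n      ≡⟨ cong (B n +_) (⋆-cong {T} (λ _ → refl) (P-suc N) n) ⟨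
    B n + (T ⋆ P (suc N)) n            ∎

  ⋆-leftComm : ∀ a b c → a ⋆ (b ⋆ c) ≗ b ⋆ (a ⋆ c)
  ⋆-leftComm a b c n = trans (sym (⋆-assoc a b c n))
    (trans (⋆-cong {b = c} (⋆-comm a b) (λ _ → refl) n) (⋆-assoc b a c n))

  ⋆-E-split : ∀ a N → a ⋆ E (ι N) ≗ a ⊕ T ⋆ (A N ⋆ a)
  ⋆-E-split a N n = begin
    (a ⋆ E (ι N)) n                  ≡⟨ ⋆-cong {a} (λ _ → refl) (T⋆A N) n ⟩
    (a ⋆ (𝟙 ⊕ T ⋆ A N)) n            ≡⟨ ⋆-distribˡ a 𝟙 (T ⋆ A N) n ⟩
    (a ⋆ 𝟙) n + (a ⋆ (T ⋆ A N)) n    ≡⟨ cong₂ _+_ (⋆-identityʳ a n) (⋆-leftComm a T (A N) n) ⟩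
    a n + (T ⋆ (a ⋆ A N)) n          ≡⟨ cong (a n +_) (⋆-cong {T} (λ _ → refl) (⋆-comm a (A N)) n) ⟩
    a n + (T ⋆ (A N ⋆ a)) n          ∎

  +-cancelˡ : ∀ x {y z} → x + y ≡ x + z → y ≡ z
  +-cancelˡ x {y} {z} eq = trans (undo x y) (trans (cong (- x +_) eq) (sym (undo x z)))
    where
    undo : ∀ x y → y ≡ - x + (x + y)
    undo = solve-∀ ℚ-ring

  -- Compares two expressions for B e^(Nt), from `B⋆E` and from e^(Nt) = 1 + t `A N`, and cancels B
  -- and then t. This is Faulhaber's formula as a product of series.
  P≡A⋆B : ∀ N → P N ≗ A N ⋆ B
  P≡A⋆B N = T⋆-cancel λ n → +-cancelˡ (B n) (trans (sym (B⋆E N n)) (⋆-E-split B N n))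

  faulhaber : ∀ N r → P N r ≡ Sum (suc r) (λ k → ι (r C k) * (ι (N ^ suc k) * inv (suc k) * B (r ∸ k)))
  faulhaber N r = trans (P≡A⋆B N r) (⋆-binomial (A N) B r)

  -- Vanishing of the odd Bernoulli numbers

  -- The substitution t ↦ - t.
  σ : Seq → Seq
  σ a n = E (- 1ℚ) n * a n

  σ-⋆ : ∀ a b → σ (a ⋆ b) ≗ σ a ⋆ σ b
  σ-⋆ a b zero    = solve₁ (a 0) (b 0)
    where
    solve₁ : ∀ x y → 1ℚ * (x * y) ≡ 1ℚ * x * (1ℚ * y)
    solve₁ = solve-∀ ℚ-ring
  σ-⋆ a b (suc n) = begin
    - 1ℚ * e * ((shift a ⋆ b) n + (a ⋆ shift b) n)                 ≡⟨ expand (- 1ℚ) e _ _ ⟩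
    - 1ℚ * (e * (shift a ⋆ b) n) + - 1ℚ * (e * (a ⋆ shift b) n)
      ≡⟨ cong₂ (λ x y → - 1ℚ * x + - 1ℚ * y) (σ-⋆ (shift a) b n) (σ-⋆ a (shift b) n) ⟩
    - 1ℚ * (σ (shift a) ⋆ σ b) n + - 1ℚ * (σ a ⋆ σ (shift b)) n
      ≡⟨ cong₂ _+_ (⋆-·ˡ (- 1ℚ) (σ (shift a)) (σ b) n) (⋆-·ʳ (- 1ℚ) (σ a) (σ (shift b)) n) ⟨
    ((- 1ℚ · σ (shift a)) ⋆ σ b) n + (σ a ⋆ (- 1ℚ · σ (shift b))) n
      ≡⟨ cong₂ _+_ (⋆-cong {b = σ b} (shift-σ a) (λ _ → refl) n) (⋆-cong {σ a} (λ _ → refl) (shift-σ b) n) ⟨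
    (shift (σ a) ⋆ σ b) n + (σ a ⋆ shift (σ b)) n                  ∎
    where
    e = E (- 1ℚ) n
    expand : ∀ m e x y → m * e * (x + y) ≡ m * (e * x) + m * (e * y)
    expand = solve-∀ ℚ-ring
    shift-σ : ∀ a → shift (σ a) ≗ - 1ℚ · σ (shift a)
    shift-σ a k = *-assoc (- 1ℚ) (E (- 1ℚ) k) (a (suc k))

  σ-T : ∀ n → σ T n ≡ - T n
  σ-T zero          = refl
  σ-T (suc zero)    = refl
  σ-T (suc (suc n)) = *-zeroʳ (E (- 1ℚ) (2 ℕ.+ n))

  -- Substituting -t in B e^t = B + t gives B(-t) e^(-t) = B(-t) - t; multiply by e^t and move t e^t
  -- across.
  σB⋆E₁ : σ B ⋆ E 1ℚ ≗ σ B ⊕ T ⋆ E 1ℚ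
  σB⋆E₁ n = begin
    (σ B ⋆ E 1ℚ) n                                            ≡⟨ +-identityʳ _ ⟨
    (σ B ⋆ E 1ℚ) n + 0ℚ                                       ≡⟨ cong ((σ B ⋆ E 1ℚ) n +_) cancel ⟨
    (σ B ⋆ E 1ℚ) n + ((σ T ⋆ E 1ℚ) n + (T ⋆ E 1ℚ) n)
      ≡⟨ +-assoc ((σ B ⋆ E 1ℚ) n) ((σ T ⋆ E 1ℚ) n) ((T ⋆ E 1ℚ) n) ⟨
    (σ B ⋆ E 1ℚ) n + (σ T ⋆ E 1ℚ) n + (T ⋆ E 1ℚ) n
      ≡⟨ cong (_+ (T ⋆ E 1ℚ) n) (⋆-distribʳ (E 1ℚ) (σ B) (σ T) n) ⟨
    ((σ B ⊕ σ T) ⋆ E 1ℚ) n + (T ⋆ E 1ℚ) n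
      ≡⟨ cong (_+ (T ⋆ E 1ℚ) n) (⋆-cong {b = E 1ℚ} σ-B⊕T (λ _ → refl) n) ⟩
    (σ B ⋆ σ (E 1ℚ) ⋆ E 1ℚ) n + (T ⋆ E 1ℚ) n
      ≡⟨ cong (_+ (T ⋆ E 1ℚ) n) (⋆-assoc (σ B) (σ (E 1ℚ)) (E 1ℚ) n) ⟩
    (σ B ⋆ (σ (E 1ℚ) ⋆ E 1ℚ)) n + (T ⋆ E 1ℚ) n
      ≡⟨ cong (_+ (T ⋆ E 1ℚ) n) (⋆-cong {σ B} (λ _ → refl) inverse n) ⟩
    (σ B ⋆ 𝟙) n + (T ⋆ E 1ℚ) n
      ≡⟨ cong (_+ (T ⋆ E 1ℚ) n) (⋆-identityʳ (σ B) n) ⟩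
    σ B n + (T ⋆ E 1ℚ) n                                      ∎
    where
    σ-B⊕T : σ B ⊕ σ T ≗ σ B ⋆ σ (E 1ℚ)
    σ-B⊕T k = trans (sym (*-distribˡ-+ (E (- 1ℚ) k) (B k) (T k)))
      (trans (cong (E (- 1ℚ) k *_) (sym (B⋆E₁ k))) (σ-⋆ B (E 1ℚ) k))
    σE₁ : σ (E 1ℚ) ≗ E (- 1ℚ)
    σE₁ k = trans (cong (E (- 1ℚ) k *_) (E-1 k)) (*-identityʳ _)
    inverse : σ (E 1ℚ) ⋆ E 1ℚ ≗ 𝟙
    inverse k = trans (⋆-cong {b = E 1ℚ} σE₁ (λ _ → refl) k) (trans (E-⋆ (- 1ℚ) 1ℚ k) (E-0 k))
    cancel : (σ T ⋆ E 1ℚ) n + (T ⋆ E 1ℚ) n ≡ 0ℚ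
    cancel = begin
      (σ T ⋆ E 1ℚ) n + (T ⋆ E 1ℚ) n   ≡⟨ ⋆-distribʳ (E 1ℚ) (σ T) T n ⟨
      ((σ T ⊕ T) ⋆ E 1ℚ) n
        ≡⟨ ⋆-cong {b = E 1ℚ} (λ k → trans (cong (_+ T k) (σ-T k)) (+-inverseˡ (T k))) (λ _ → refl) n ⟩
      (𝟘 ⋆ E 1ℚ) n                    ≡⟨ ⋆-zeroˡ (E 1ℚ) n ⟩
      0ℚ                              ∎

  -- The hypothesis says A 1 ⋆ c ≗ E 1ℚ, and A 1 has the inverse B.
  ⋆E₁-determines : ∀ a b → a ⋆ E 1ℚ ≗ a ⊕ T ⋆ E 1ℚ → b ⋆ E 1ℚ ≗ b ⊕ T ⋆ E 1ℚ → a ≗ b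
  ⋆E₁-determines a b a-eq b-eq n = begin
    a n                     ≡⟨ recover a a-eq n ⟩
    (B ⋆ E 1ℚ) n            ≡⟨ recover b b-eq n ⟨
    b n                     ∎
    where
    recover : ∀ c → c ⋆ E 1ℚ ≗ c ⊕ T ⋆ E 1ℚ → c ≗ B ⋆ E 1ℚ
    recover c eq k = begin
      c k                     ≡⟨ ⋆-identityˡ c k ⟨
      -- Since 0 ^ 0 = 1, the series `P 1` is 1, so `P≡A⋆B 1` exhibits `B` as the inverse of `A 1`.
      (𝟙 ⋆ c) k               ≡⟨ ⋆-cong {b = c} P₁ (λ _ → refl) k ⟨
      (P 1 ⋆ c) k
        ≡⟨ ⋆-cong {b = c} (λ j → trans (P≡A⋆B 1 j) (⋆-comm (A 1) B j)) (λ _ → refl) k ⟩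
      (B ⋆ A 1 ⋆ c) k         ≡⟨ ⋆-assoc B (A 1) c k ⟩
      (B ⋆ (A 1 ⋆ c)) k       ≡⟨ ⋆-cong {B} (λ _ → refl) A⋆c k ⟩
      (B ⋆ E 1ℚ) k            ∎
      where
      P₁ : P 1 ≗ 𝟙
      P₁ zero    = refl
      P₁ (suc j) = refl
      A⋆c : A 1 ⋆ c ≗ E 1ℚ
      A⋆c = T⋆-cancel λ j → +-cancelˡ (c j) (trans (sym (⋆-E-split c 1 j)) (eq j))

  -- Multiplying out with B e^t = B + t shows that B + t solves the same equation c e^t = c + t e^t
  -- as B(-t).
  σB≡B⊕T : σ B ≗ B ⊕ T
  σB≡B⊕T = ⋆E₁-determines (σ B) (B ⊕ T) σB⋆E₁ λ n →
    trans (⋆-distribʳ (E 1ℚ) B T n) (cong (_+ (T ⋆ E 1ℚ) n) (B⋆E₁ n))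

  E₋₁-odd : ∀ k → E (- 1ℚ) (suc (k ℕ.+ k)) ≡ - 1ℚ
  E₋₁-odd zero    = refl
  E₋₁-odd (suc k) = begin
    - 1ℚ * (- 1ℚ * E (- 1ℚ) (k ℕ.+ suc k))
      ≡⟨ cong (λ j → - 1ℚ * (- 1ℚ * E (- 1ℚ) j)) (ℕₚ.+-suc k k) ⟩
    - 1ℚ * (- 1ℚ * E (- 1ℚ) (suc (k ℕ.+ k)))     ≡⟨ cong (λ x → - 1ℚ * (- 1ℚ * x)) (E₋₁-odd k) ⟩
    - 1ℚ                                         ∎

  -- At an odd index above 1, `σB≡B⊕T` reads -b = b + 0. Index 1 escapes because of the summand t.
  B-odd : ∀ k → B (3 ℕ.+ (k ℕ.+ k)) ≡ 0ℚ
  B-odd k = *-cancel-ι 2 (begin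
    ι 2 * b                                  ≡⟨ double b ⟩
    b + 0ℚ - - 1ℚ * b
      ≡⟨ cong (λ x → b + 0ℚ - x) (trans (cong (_* b) (sym sign)) (σB≡B⊕T (3 ℕ.+ (k ℕ.+ k)))) ⟩
    b + 0ℚ - (b + 0ℚ)                        ≡⟨ +-inverseʳ (b + 0ℚ) ⟩
    ι 2 * 0ℚ                                 ∎)
    where
    b = B (3 ℕ.+ (k ℕ.+ k))
    double : ∀ x → (1ℚ + 1ℚ) * x ≡ x + 0ℚ - - 1ℚ * x
    double = solve-∀ ℚ-ring
    sign : E (- 1ℚ) (3 ℕ.+ (k ℕ.+ k)) ≡ - 1ℚ
    sign = trans (cong (λ j → E (- 1ℚ) (2 ℕ.+ j)) (sym (ℕₚ.+-suc k k))) (E₋₁-odd (suc k))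

module Harmonic (p : ℕ) (p-prime : Prime p) (5≤p : 5 ≤ p) where
  open Bernoulli
  open Data.Rational using (_+_; _*_; _-_; -_)
  open ≡-Reasoning

  instance
    p≢0 : NonZero p
    p≢0 = prime⇒nonZero p-prime

  p^≢0 : ∀ s → NonZero (p ^ s)
  p^≢0 s = ℕₚ.m^n≢0 p s

  p∤1 : p ∤ 1
  p∤1 p∣1 with subst (5 ≤_) (∣1⇒≡1 p∣1) 5≤p
  ... | s≤s ()

  p∤* : ∀ {m n} → p ∤ m → p ∤ n → p ∤ m ℕ.* n
  p∤* p∤m p∤n p∣mn = [ p∤m , p∤n ]′ (euclidsLemma _ _ p-prime p∣mn)

  p∤< : ∀ {n} → suc n < p → p ∤ suc n
  p∤< n<p p∣n = ℕₚ.<⇒≱ n<p (∣⇒≤ p∣n)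

  p∤⇒nonZero : ∀ {n} → p ∤ n → NonZero n
  p∤⇒nonZero {zero}  p∤0 = contradiction (p ∣0) p∤0
  p∤⇒nonZero {suc n} _   = _

  -- Valuations

  -- Any denominator prime to p is a witness, reduced or not, so sums and products simply multiply
  -- denominators.
  record Integral (q : ℚ) : Set where
    constructor integral
    field
      den   : ℕ
      num   : ℤ
      p∤den : p ∤ den
      q*den : q * ι den ≡ ζ num

  Integral-ζ : ∀ z → Integral (ζ z)
  Integral-ζ z = integral 1 z p∤1 (*-identityʳ (ζ z))

  Integral-ι : ∀ n → Integral (ι n)
  Integral-ι n = Integral-ζ (ℤ.+ n)

  Integral-inv : ∀ {n} → p ∤ n → Integral (inv n)
  Integral-inv {n} p∤n = integral n (ℤ.+ 1) p∤n (trans (*-comm (inv n) (ι n)) (ι*inv n {{p∤⇒nonZero p∤n}}))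

  Integral-+ : ∀ {q r} → Integral q → Integral r → Integral (q + r)
  Integral-+ {q} {r} (integral d a p∤d qd) (integral e b p∤e re) =
    integral (d ℕ.* e) (a ℤ.* ℤ.+ e ℤ.+ b ℤ.* ℤ.+ d) (p∤* p∤d p∤e) (begin
      (q + r) * ι (d ℕ.* e)            ≡⟨ cong ((q + r) *_) (ι-* d e) ⟩
      (q + r) * (ι d * ι e)            ≡⟨ expand q r (ι d) (ι e) ⟩
      q * ι d * ι e + r * ι e * ι d    ≡⟨ cong₂ (λ x y → x * ι e + y * ι d) qd re ⟩
      ζ a * ι e + ζ b * ι d            ≡⟨ cong₂ _+_ (ζ-* a (ℤ.+ e)) (ζ-* b (ℤ.+ d)) ⟨
      ζ (a ℤ.* ℤ.+ e) + ζ (b ℤ.* ℤ.+ d) ≡⟨ ζ-+ (a ℤ.* ℤ.+ e) (b ℤ.* ℤ.+ d) ⟨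
      ζ (a ℤ.* ℤ.+ e ℤ.+ b ℤ.* ℤ.+ d)  ∎)
    where
    expand : ∀ q r d e → (q + r) * (d * e) ≡ q * d * e + r * e * d
    expand = solve-∀ ℚ-ring

  Integral-* : ∀ {q r} → Integral q → Integral r → Integral (q * r)
  Integral-* {q} {r} (integral d a p∤d qd) (integral e b p∤e re) =
    integral (d ℕ.* e) (a ℤ.* b) (p∤* p∤d p∤e) (begin
      q * r * ι (d ℕ.* e)      ≡⟨ cong (q * r *_) (ι-* d e) ⟩
      q * r * (ι d * ι e)      ≡⟨ expand q r (ι d) (ι e) ⟩
      q * ι d * (r * ι e)      ≡⟨ cong₂ _*_ qd re ⟩
      ζ a * ζ b                ≡⟨ ζ-* a b ⟨
      ζ (a ℤ.* b)              ∎)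
    where
    expand : ∀ q r d e → q * r * (d * e) ≡ q * d * (r * e)
    expand = solve-∀ ℚ-ring

  Integral-neg : ∀ {q} → Integral q → Integral (- q)
  Integral-neg {q} (integral d a p∤d qd) = integral d (ℤ.- a) p∤d
    (trans (sym (neg-distribˡ-* q (ι d))) (trans (cong -_ qd) (sym (ζ-neg a))))

  infix 4 ord≥
  syntax ord≥ s q = ordₚ q ≥ s

  -- The inequality ν_p(q) ≥ s, encoded as membership in p^s times the localisation of the integers
  -- at p. Zero belongs for every s.
  record ord≥ (s : ℕ) (q : ℚ) : Set where
    constructor divisible
    field
      quotient   : ℚ
      isIntegral : Integral quotient
      factor     : q ≡ ι (p ^ s) * quotient

  ord-resp : ∀ {s q r} → q ≡ r → ordₚ q ≥ s → ordₚ r ≥ s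
  ord-resp {s} = subst (ord≥ s)

  ord-+ : ∀ {s q r} → ordₚ q ≥ s → ordₚ r ≥ s → ordₚ q + r ≥ s
  ord-+ {s} (divisible q′ qi refl) (divisible r′ ri refl) =
    divisible (q′ + r′) (Integral-+ qi ri) (sym (*-distribˡ-+ (ι (p ^ s)) q′ r′))

  ord-neg : ∀ {s q} → ordₚ q ≥ s → ordₚ - q ≥ s
  ord-neg {s} (divisible q′ qi refl) = divisible (- q′) (Integral-neg qi) (neg-distribʳ-* (ι (p ^ s)) q′)

  ord-- : ∀ {s q r} → ordₚ q ≥ s → ordₚ r ≥ s → ordₚ q - r ≥ s
  ord-- q≥s r≥s = ord-+ q≥s (ord-neg r≥s)

  ord-trans : ∀ {s} q r t → ordₚ q - r ≥ s → ordₚ r - t ≥ s → ordₚ q - t ≥ s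
  ord-trans q r t x y = ord-resp (telescope q r t) (ord-+ x y)
    where
    telescope : ∀ q r t → q - r + (r - t) ≡ q - t
    telescope = solve-∀ ℚ-ring

  ord-* : ∀ {s t q r} → ordₚ q ≥ s → ordₚ r ≥ t → ordₚ q * r ≥ s ℕ.+ t
  ord-* {s} {t} (divisible q′ qi refl) (divisible r′ ri refl) = divisible (q′ * r′) (Integral-* qi ri) (begin
    ι (p ^ s) * q′ * (ι (p ^ t) * r′)      ≡⟨ *-interchange (ι (p ^ s)) q′ (ι (p ^ t)) r′ ⟩
    ι (p ^ s) * ι (p ^ t) * (q′ * r′)      ≡⟨ cong (_* (q′ * r′)) (ι-* (p ^ s) (p ^ t)) ⟨
    ι (p ^ s ℕ.* p ^ t) * (q′ * r′)
      ≡⟨ cong (λ x → ι x * (q′ * r′)) (ℕₚ.^-distribˡ-+-* p s t) ⟨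
    ι (p ^ (s ℕ.+ t)) * (q′ * r′)          ∎)

  ord≥0 : ∀ {q} → Integral q → ordₚ q ≥ 0
  ord≥0 {q} qi = divisible q qi (sym (*-identityˡ q))

  ord-integral : ∀ {s q} → ordₚ q ≥ s → Integral q
  ord-integral {s} (divisible q′ qi refl) = Integral-* (Integral-ι (p ^ s)) qi

  ord-*ʳ : ∀ {s q r} → ordₚ q ≥ s → Integral r → ordₚ q * r ≥ s
  ord-*ʳ {s} {q} {r} q≥s ri = subst (λ t → ord≥ t (q * r)) (ℕₚ.+-identityʳ s) (ord-* q≥s (ord≥0 ri))

  ord-*ˡ : ∀ {s q r} → Integral q → ordₚ r ≥ s → ordₚ q * r ≥ s
  ord-*ˡ qi r≥s = ord-* (ord≥0 qi) r≥s

  ord-ι^ : ∀ s → ordₚ ι (p ^ s) ≥ s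
  ord-ι^ s = divisible 1ℚ (Integral-ι 1) (sym (*-identityʳ _))

  ord-0 : ∀ s → ordₚ 0ℚ ≥ s
  ord-0 s = divisible 0ℚ (Integral-ι 0) (sym (*-zeroʳ (ι (p ^ s))))

  ord-≤ : ∀ {s t q} → s ≤ t → ordₚ q ≥ t → ordₚ q ≥ s
  ord-≤ {s} {t} {q} s≤t (divisible q′ qi refl) = ord-resp {s} {ι (p ^ s) * (ι (p ^ (t ∸ s)) * q′)} (begin
    ι (p ^ s) * (ι (p ^ (t ∸ s)) * q′)     ≡⟨ *-assoc (ι (p ^ s)) (ι (p ^ (t ∸ s))) q′ ⟨
    ι (p ^ s) * ι (p ^ (t ∸ s)) * q′       ≡⟨ cong (_* q′) (ι-* (p ^ s) (p ^ (t ∸ s))) ⟨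
    ι (p ^ s ℕ.* p ^ (t ∸ s)) * q′
      ≡⟨ cong (λ x → ι x * q′) (ℕₚ.^-distribˡ-+-* p s (t ∸ s)) ⟨
    ι (p ^ (s ℕ.+ (t ∸ s))) * q′           ≡⟨ cong (λ x → ι (p ^ x) * q′) (ℕₚ.m+[n∸m]≡n s≤t) ⟩
    ι (p ^ t) * q′                         ∎)
    (divisible _ (Integral-* (Integral-ι (p ^ (t ∸ s))) qi) refl)

  ord-∣ : ∀ {n} → p ∣ n → ordₚ ι n ≥ 1
  ord-∣ (divides k refl) = divisible (ι k) (Integral-ι k) (begin
    ι (k ℕ.* p)            ≡⟨ cong ι (ℕₚ.*-comm k p) ⟩
    ι (p ℕ.* k)            ≡⟨ cong (λ x → ι (x ℕ.* k)) (ℕₚ.^-identityʳ p) ⟨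
    ι (p ^ 1 ℕ.* k)        ≡⟨ ι-* (p ^ 1) k ⟩
    ι (p ^ 1) * ι k        ∎)

  ord-Sum : ∀ {s} n {f} → (∀ i → i < n → ordₚ f i ≥ s) → ordₚ Sum n f ≥ s
  ord-Sum {s} zero    h = ord-0 s
  ord-Sum     (suc n) h = ord-+ (h 0 (s≤s z≤n)) (ord-Sum n λ i i<n → h (suc i) (s≤s i<n))

  ord-/p^ : ∀ h {s q} → ordₚ q ≥ h ℕ.+ s → ordₚ inv (p ^ h) * q ≥ s
  ord-/p^ h {s} (divisible q′ qi refl) = divisible q′ qi (begin
    inv (p ^ h) * (ι (p ^ (h ℕ.+ s)) * q′)
      ≡⟨ cong (λ x → inv (p ^ h) * (ι x * q′)) (ℕₚ.^-distribˡ-+-* p h s) ⟩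
    inv (p ^ h) * (ι (p ^ h ℕ.* p ^ s) * q′)
      ≡⟨ cong (λ x → inv (p ^ h) * (x * q′)) (ι-* (p ^ h) (p ^ s)) ⟩
    inv (p ^ h) * (ι (p ^ h) * ι (p ^ s) * q′)
      ≡⟨ regroup (inv (p ^ h)) (ι (p ^ h)) (ι (p ^ s)) q′ ⟩
    ι (p ^ h) * inv (p ^ h) * (ι (p ^ s) * q′)
      ≡⟨ cong (_* (ι (p ^ s) * q′)) (ι*inv (p ^ h) {{p^≢0 h}}) ⟩
    1ℚ * (ι (p ^ s) * q′)                        ≡⟨ *-identityˡ _ ⟩
    ι (p ^ s) * q′                               ∎)
    where
    regroup : ∀ a b c d → a * (b * c * d) ≡ b * a * (c * d)
    regroup = solve-∀ ℚ-ring

  -- Clearing denominators makes the numerator of q times `d` a multiple of p. As p does not divide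
  -- `d`, Euclid's lemma puts p into the numerator.
  ord-sound : ∀ {q} → ordₚ q ≥ 1 → ν p ≥1 q
  ord-sound {q} (divisible r (integral d z p∤d r*d) q≡pr) =
    [ id , (λ p∣d → contradiction p∣d p∤d) ]′ (euclidsLemma ∣ ↥ q ∣ d p-prime p∣↥q*d)
    where
    clear : ζ (↥ q ℤ.* ℤ.+ d) ≡ ζ (ℤ.+ p ℤ.* (z ℤ.* ℤ.+ ↧ₙ q))
    clear = begin
      ζ (↥ q ℤ.* ℤ.+ d)                     ≡⟨ ζ-* (↥ q) (ℤ.+ d) ⟩
      ζ (↥ q) * ι d                         ≡⟨ cong (_* ι d) (q*↧q≡↥q q) ⟨
      q * ι (↧ₙ q) * ι d
        ≡⟨ cong (λ x → x * ι (↧ₙ q) * ι d) (trans q≡pr (cong (λ x → ι x * r) (ℕₚ.^-identityʳ p))) ⟩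
      ι p * r * ι (↧ₙ q) * ι d              ≡⟨ regroup (ι p) r (ι (↧ₙ q)) (ι d) ⟩
      ι p * (r * ι d * ι (↧ₙ q))            ≡⟨ cong (λ x → ι p * (x * ι (↧ₙ q))) r*d ⟩
      ι p * (ζ z * ι (↧ₙ q))                ≡⟨ cong (ι p *_) (ζ-* z (ℤ.+ ↧ₙ q)) ⟨
      ι p * ζ (z ℤ.* ℤ.+ ↧ₙ q)              ≡⟨ ζ-* (ℤ.+ p) (z ℤ.* ℤ.+ ↧ₙ q) ⟨
      ζ (ℤ.+ p ℤ.* (z ℤ.* ℤ.+ ↧ₙ q))        ∎
      where
      regroup : ∀ a b c d → a * b * c * d ≡ a * (b * d * c)
      regroup = solve-∀ ℚ-ring
    p∣↥q*d : p ∣ ∣ ↥ q ∣ ℕ.* d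
    p∣↥q*d = subst (p ∣_) (begin
      p ℕ.* ∣ z ℤ.* ℤ.+ ↧ₙ q ∣              ≡⟨ ℤₚ.abs-* (ℤ.+ p) (z ℤ.* ℤ.+ ↧ₙ q) ⟨
      ∣ ℤ.+ p ℤ.* (z ℤ.* ℤ.+ ↧ₙ q) ∣
        ≡⟨ cong ∣_∣ (ζ-injective {↥ q ℤ.* ℤ.+ d} {ℤ.+ p ℤ.* (z ℤ.* ℤ.+ ↧ₙ q)} clear) ⟨
      ∣ ↥ q ℤ.* ℤ.+ d ∣                     ≡⟨ ℤₚ.abs-* (↥ q) (ℤ.+ d) ⟩
      ∣ ↥ q ∣ ℕ.* d                         ∎) (m∣m*n ∣ z ℤ.* ℤ.+ ↧ₙ q ∣)

  -- The bound forces ν_p(k) ≤ t. The recursion strips one p from `k` and lowers `t`; at t = 0 a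
  -- positive multiple of p cannot lie below p.
  p^t/k-integral : ∀ t k .{{_ : NonZero k}} → k < p ^ suc t → Integral (ι (p ^ t) * inv k)
  p^t/k-integral t k k<p^1+t with p ∣? k
  ... | no p∤k = Integral-* (Integral-ι (p ^ t)) (Integral-inv p∤k)
  p^t/k-integral zero k k<p | yes p∣k =
    contradiction (∣⇒≤ p∣k) (ℕₚ.<⇒≱ (subst (k <_) (ℕₚ.^-identityʳ p) k<p))
  p^t/k-integral (suc t) k k<p^2+t | yes (divides zero refl) = contradiction refl (ℕ.≢-nonZero⁻¹ 0)
  p^t/k-integral (suc t) k k<p^2+t | yes (divides j@(suc _) refl) = subst Integral (begin
    ι (p ^ t) * inv j                              ≡⟨ *-identityˡ _ ⟨
    1ℚ * (ι (p ^ t) * inv j)                       ≡⟨ cong (_* (ι (p ^ t) * inv j)) (ι*inv p) ⟨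
    ι p * inv p * (ι (p ^ t) * inv j)              ≡⟨ regroup (ι p) (inv p) (ι (p ^ t)) (inv j) ⟩
    ι p * ι (p ^ t) * (inv j * inv p)              ≡⟨ cong₂ _*_ (ι-* p (p ^ t)) (inv-* j p) ⟨
    ι (p ^ suc t) * inv (j ℕ.* p)                  ∎)
    (p^t/k-integral t j (ℕₚ.*-cancelˡ-< p j (p ^ suc t) (subst (_< p ^ suc (suc t)) (ℕₚ.*-comm j p) k<p^2+t)))
    where
    regroup : ∀ a b c d → a * b * (c * d) ≡ a * c * (d * b)
    regroup = solve-∀ ℚ-ring

  ord-p^/k : ∀ s t k .{{_ : NonZero k}} → k < p ^ suc t → ordₚ ι (p ^ (s ℕ.+ t)) * inv k ≥ s
  ord-p^/k s t k k<p^1+t = divisible _ (p^t/k-integral t k k<p^1+t) (begin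
    ι (p ^ (s ℕ.+ t)) * inv k            ≡⟨ cong (λ x → ι x * inv k) (ℕₚ.^-distribˡ-+-* p s t) ⟩
    ι (p ^ s ℕ.* p ^ t) * inv k          ≡⟨ cong (_* inv k) (ι-* (p ^ s) (p ^ t)) ⟩
    ι (p ^ s) * ι (p ^ t) * inv k        ≡⟨ *-assoc (ι (p ^ s)) (ι (p ^ t)) (inv k) ⟩
    ι (p ^ s) * (ι (p ^ t) * inv k)      ∎)

  -- Fermat's and Euler's theorems

  p∤! : ∀ k → k < p → p ∤ k !
  p∤! zero    _   = p∤1
  p∤! (suc k) k<p = p∤* (p∤< k<p) (p∤! k (ℕₚ.<-trans (ℕₚ.n<1+n k) k<p))

  p∣p! : p ∣ p !
  p∣p! = subst (λ n → n ∣ n !) (ℕₚ.suc-pred p) (m∣m*n (ℕ.pred p !))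

  p∣pCk : ∀ k → 0 < k → k < p → p ∣ p C k
  p∣pCk k 0<k k<p = [ id ,
    (λ x → contradiction x (p∤* (p∤! k k<p) (p∤! (p ∸ k) (ℕₚ.∸-monoʳ-< 0<k (ℕₚ.<⇒≤ k<p))))) ]′
    (euclidsLemma (p C k) (k ! ℕ.* (p ∸ k) !) p-prime (subst (p ∣_) (sym pCk*) p∣p!))
    where
    instance
      _ = k ℕₚ.!* (p ∸ k) !≢0
    pCk* : (p C k) ℕ.* (k ! ℕ.* (p ∸ k) !) ≡ p !
    pCk* = trans (cong (ℕ._* (k ! ℕ.* (p ∸ k) !)) (nCk≡n!/k![n-k]! (ℕₚ.<⇒≤ k<p)))
      (ℕ/.m/n*n≡m (k![n∸k]!∣n! (ℕₚ.<⇒≤ k<p)))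

  -- Induction on i: the inner binomial coefficients of (i + 1)^p are divisible by p, which leaves
  -- i^p + 1.
  fermat : ∀ i → ordₚ ι (i ^ p) - ι i ≥ 1
  fermat zero = ord-resp {1} {0ℚ} (sym (cong (λ n → ι n - 0ℚ) 0^p≡0)) (ord-0 1)
    where
    0^p≡0 : 0 ^ p ≡ 0
    0^p≡0 = cong (0 ^_) (sym (ℕₚ.suc-pred p))
  fermat (suc i) = ord-resp (begin
    Sum p₁ (f ∘ suc) + (ι (i ^ p) - ι i)
      ≡⟨ regroup (Sum p₁ (f ∘ suc)) (ι (i ^ p)) (ι i) ⟩
    1ℚ + (Sum p₁ (f ∘ suc) + ι (i ^ p)) - (1ℚ + ι i)
      ≡⟨ cong₂ _-_ (sym binomial) (sym (ι-suc i)) ⟩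
    ι (suc i ^ p) - ι (suc i)                                  ∎)
    (ord-+ (ord-Sum p₁ λ k k<p₁ → ord-*ʳ
      (ord-∣ (p∣pCk (suc k) (s≤s z≤n) (subst (suc k <_) (ℕₚ.suc-pred p) (s≤s k<p₁))))
      (Integral-ι (i ^ suc k))) (fermat i))
    where
    p₁ = ℕ.pred p
    f : ℕ → ℚ
    f k = ι (p C k) * ι (i ^ k)
    regroup : ∀ a b c → a + (b - c) ≡ 1ℚ + (a + b) - (1ℚ + c)
    regroup = solve-∀ ℚ-ring
    binomial : ι (suc i ^ p) ≡ 1ℚ + (Sum p₁ (f ∘ suc) + ι (i ^ p))
    binomial = begin
      ι (suc i ^ p)                                              ≡⟨ E-ι (suc i) p ⟨
      E (ι (suc i)) p
        ≡⟨ cong (λ x → E x p) (trans (ι-suc i) (+-comm 1ℚ (ι i))) ⟩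
      E (ι i + 1ℚ) p                                             ≡⟨ E-⋆ (ι i) 1ℚ p ⟨
      (E (ι i) ⋆ E 1ℚ) p                                         ≡⟨ ⋆-binomial (E (ι i)) (E 1ℚ) p ⟩
      Sum (suc p) (λ k → ι (p C k) * (E (ι i) k * E 1ℚ (p ∸ k)))
        ≡⟨ Sum-cong (suc p) (λ k _ → cong (ι (p C k) *_)
          (trans (cong₂ _*_ (E-ι i k) (E-1 (p ∸ k))) (*-identityʳ (ι (i ^ k))))) ⟩
      1ℚ + Sum p (f ∘ suc)
        ≡⟨ cong (λ n → 1ℚ + Sum n (f ∘ suc)) (ℕₚ.suc-pred p) ⟨
      1ℚ + Sum (suc p₁) (f ∘ suc)
        ≡⟨ cong (1ℚ +_) (Sum-suc p₁ (f ∘ suc)) ⟩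
      1ℚ + (Sum p₁ (f ∘ suc) + f (suc p₁))
        ≡⟨ cong (λ n → 1ℚ + (Sum p₁ (f ∘ suc) + f n)) (ℕₚ.suc-pred p) ⟩
      1ℚ + (Sum p₁ (f ∘ suc) + f p)
        ≡⟨ cong (λ c → 1ℚ + (Sum p₁ (f ∘ suc) + ι c * ι (i ^ p))) (nCn≡1 p) ⟩
      1ℚ + (Sum p₁ (f ∘ suc) + 1ℚ * ι (i ^ p))
        ≡⟨ cong (λ x → 1ℚ + (Sum p₁ (f ∘ suc) + x)) (*-identityˡ _) ⟩
      1ℚ + (Sum p₁ (f ∘ suc) + ι (i ^ p))                        ∎

  p≡1+[p∸1] : p ≡ suc (p ∸ 1)
  p≡1+[p∸1] = sym (ℕₚ.m+[n∸m]≡n (ℕₚ.≤-trans (s≤s z≤n) 5≤p))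

  fermat-unit : ∀ {i} → p ∤ i → ordₚ ι (i ^ (p ∸ 1)) - 1ℚ ≥ 1
  fermat-unit {i} p∤i = ord-resp (begin
    inv i * (ι (i ^ p) - ι i)
      ≡⟨ cong (λ n → inv i * (ι (i ^ n) - ι i)) p≡1+[p∸1] ⟩
    inv i * (ι (i ℕ.* i ^ (p ∸ 1)) - ι i)
      ≡⟨ cong (λ x → inv i * (x - ι i)) (ι-* i (i ^ (p ∸ 1))) ⟩
    inv i * (ι i * ι (i ^ (p ∸ 1)) - ι i)          ≡⟨ regroup (inv i) (ι i) (ι (i ^ (p ∸ 1))) ⟩
    ι i * inv i * (ι (i ^ (p ∸ 1)) - 1ℚ)
      ≡⟨ cong (_* (ι (i ^ (p ∸ 1)) - 1ℚ)) (ι*inv i {{p∤⇒nonZero p∤i}}) ⟩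
    1ℚ * (ι (i ^ (p ∸ 1)) - 1ℚ)                    ≡⟨ *-identityˡ _ ⟩
    ι (i ^ (p ∸ 1)) - 1ℚ                           ∎)
    (ord-*ˡ (Integral-inv p∤i) (fermat i))
    where
    regroup : ∀ a b c → a * (b * c - b) ≡ b * a * (c - 1ℚ)
    regroup = solve-∀ ℚ-ring

  -- The sum 1 + x + ... + x^(n-1) in Horner form.
  geometric : ℚ → ℕ → ℚ
  geometric x zero    = 0ℚ
  geometric x (suc n) = x * geometric x n + 1ℚ

  geometric-* : ∀ x n → (x - 1ℚ) * geometric x n ≡ E x n - 1ℚ
  geometric-* x zero    = *-zeroʳ (x - 1ℚ)
  geometric-* x (suc n) = begin
    (x - 1ℚ) * (x * geometric x n + 1ℚ)              ≡⟨ expand x (geometric x n) ⟩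
    x * ((x - 1ℚ) * geometric x n) + (x - 1ℚ)
      ≡⟨ cong (λ y → x * y + (x - 1ℚ)) (geometric-* x n) ⟩
    x * (E x n - 1ℚ) + (x - 1ℚ)                      ≡⟨ collect x (E x n) ⟩
    x * E x n - 1ℚ                                   ∎
    where
    expand : ∀ x g → (x - 1ℚ) * (x * g + 1ℚ) ≡ x * ((x - 1ℚ) * g) + (x - 1ℚ)
    expand = solve-∀ ℚ-ring
    collect : ∀ x e → x * (e - 1ℚ) + (x - 1ℚ) ≡ x * e - 1ℚ
    collect = solve-∀ ℚ-ring

  geometric-integral : ∀ {x} → Integral x → ∀ n → Integral (geometric x n)
  geometric-integral xi zero    = Integral-ι 0
  geometric-integral xi (suc n) = Integral-+ (Integral-* xi (geometric-integral xi n)) (Integral-ι 1)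

  geometric-≡ : ∀ {x} → Integral x → ordₚ x - 1ℚ ≥ 1 → ∀ n → ordₚ geometric x n - ι n ≥ 1
  geometric-≡ {x} xi x≡1 zero    = ord-0 1
  geometric-≡ {x} xi x≡1 (suc n) = ord-resp (begin
    (x - 1ℚ) * geometric x n + (geometric x n - ι n)    ≡⟨ regroup x (geometric x n) (ι n) ⟩
    x * geometric x n + 1ℚ - (1ℚ + ι n)
      ≡⟨ cong (λ y → x * geometric x n + 1ℚ - y) (ι-suc n) ⟨
    x * geometric x n + 1ℚ - ι (suc n)                  ∎)
    (ord-+ (ord-*ʳ x≡1 (geometric-integral xi n)) (geometric-≡ xi x≡1 n))
    where
    regroup : ∀ x g n → (x - 1ℚ) * g + (g - n) ≡ x * g + 1ℚ - (1ℚ + n)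
    regroup = solve-∀ ℚ-ring

  ord-^ : ∀ {x} → Integral x → ordₚ x - 1ℚ ≥ 1 → ∀ n → ordₚ E x n - 1ℚ ≥ 1
  ord-^ {x} xi x≡1 n = ord-resp (geometric-* x n) (ord-*ʳ x≡1 (geometric-integral xi n))

  -- In x^p - 1 = (x - 1)(1 + x + ... + x^(p-1)) the second factor is congruent to p, hence to 0,
  -- modulo p; it supplies the extra power.
  ord-^p : ∀ {s x} → Integral x → ordₚ x - 1ℚ ≥ suc s → ordₚ E x p - 1ℚ ≥ suc (suc s)
  ord-^p {s} {x} xi x≡1 = subst (λ t → ord≥ t (E x p - 1ℚ)) (ℕₚ.+-comm (suc s) 1)
    (ord-resp (geometric-* x p) (ord-* x≡1 (ord-resp (cancel (geometric x p) (ι p))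
      (ord-+ (geometric-≡ xi (ord-≤ (s≤s z≤n) x≡1) p) (ord-∣ (divides 1 (sym (ℕₚ.*-identityˡ p))))))))
    where
    cancel : ∀ g n → g - n + n ≡ g
    cancel = solve-∀ ℚ-ring

  euler : ∀ {i} → p ∤ i → ∀ h → ordₚ ι (i ^ (p ^ h ℕ.* (p ∸ 1))) - 1ℚ ≥ suc h
  euler {i} p∤i zero = subst (λ n → ord≥ 1 (ι (i ^ n) - 1ℚ)) (sym (ℕₚ.*-identityˡ (p ∸ 1))) (fermat-unit p∤i)
  euler {i} p∤i (suc h) = ord-resp (cong (_- 1ℚ) (begin
    E (ι (i ^ M)) p                       ≡⟨ E-ι (i ^ M) p ⟩
    ι ((i ^ M) ^ p)                       ≡⟨ cong ι (ℕₚ.^-*-assoc i M p) ⟩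
    ι (i ^ (M ℕ.* p))
      ≡⟨ cong (λ n → ι (i ^ n)) (trans (ℕₚ.*-comm M p) (sym (ℕₚ.*-assoc p (p ^ h) (p ∸ 1)))) ⟩
    ι (i ^ (p ^ suc h ℕ.* (p ∸ 1)))       ∎))
    (ord-^p (Integral-ι (i ^ M)) (euler p∤i h))
    where
    M = p ^ h ℕ.* (p ∸ 1)

  -- Integrality of Bernoulli numbers

  lowerTerm : ℕ → ℕ → ℕ → ℚ
  lowerTerm N r k = ι (r C suc k) * (ι (N ^ (2 ℕ.+ k)) * inv (2 ℕ.+ k) * B (r ∸ suc k))

  faulhaber-leading : ∀ N r → ι N * B r ≡ P N r - Sum r (lowerTerm N r)
  faulhaber-leading N r = begin
    ι N * B r                                                   ≡⟨ isolate (ι N) (B r) s ⟩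
    1ℚ * (ι N * 1ℚ * B r) + s - s
      ≡⟨ cong (λ x → 1ℚ * (ι x * 1ℚ * B r) + s - s) (ℕₚ.*-identityʳ N) ⟨
    1ℚ * (ι (N ^ 1) * inv 1 * B r) + s - s                      ≡⟨ cong (_- s) (faulhaber N r) ⟨
    P N r - s                                                   ∎
    where
    s = Sum r (lowerTerm N r)
    isolate : ∀ n b s → n * b ≡ 1ℚ * (n * 1ℚ * b) + s - s
    isolate = solve-∀ ℚ-ring

  -- Compares the denominators of Faulhaber's formula with the powers of p that must absorb them.
  n+n<p^n : ∀ n → n ℕ.+ n < p ^ n
  n+n<p^n zero    = s≤s z≤n
  n+n<p^n (suc n) = ℕₚ.≤-trans
    (subst (_≤ 3 ℕ.* p ^ n) (cong (2 ℕ.+_) (sym (ℕₚ.+-suc n n)))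
      (ℕₚ.≤-trans (ℕₚ.≤-reflexive (ℕₚ.+-comm 2 (suc (n ℕ.+ n))))
        (ℕₚ.+-mono-≤ (n+n<p^n n) (ℕₚ.+-mono-≤ p^n≥1 (ℕₚ.≤-trans p^n≥1 (ℕₚ.m≤m+n (p ^ n) 0))))))
    (ℕₚ.*-monoˡ-≤ (p ^ n) (ℕₚ.≤-trans (s≤s (s≤s (s≤s z≤n))) 5≤p))
    where
    p^n≥1 : 1 ≤ p ^ n
    p^n≥1 = ℕₚ.m^n>0 p n

  2+n<p^[1+n] : ∀ n → 2 ℕ.+ n < p ^ suc n
  2+n<p^[1+n] n = ℕₚ.≤-<-trans (s≤s (ℕₚ.m≤n+m (suc n) n)) (n+n<p^n (suc n))

  -- One p is lent to `b`, since p B is integral where B need not be; p^k remains for the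
  -- denominator k + 1.
  extract-p : ∀ N k b → ι (p ^ suc k ℕ.* N) * inv (suc k) * b ≡ ι (p ^ k) * inv (suc k) * (ι p * b) * ι N
  extract-p N k b = begin
    ι (p ℕ.* p ^ k ℕ.* N) * inv (suc k) * b
      ≡⟨ cong (λ x → x * inv (suc k) * b) (trans (ι-* (p ℕ.* p ^ k) N) (cong (_* ι N) (ι-* p (p ^ k)))) ⟩
    ι p * ι (p ^ k) * ι N * inv (suc k) * b
      ≡⟨ regroup (ι p) (ι (p ^ k)) (ι N) (inv (suc k)) b ⟩
    ι (p ^ k) * inv (suc k) * (ι p * b) * ι N         ∎
    where
    regroup : ∀ p q n i b → p * q * n * i * b ≡ q * i * (p * b) * n
    regroup = solve-∀ ℚ-ring

  extract-p₁ : ∀ k b → ι (p ^ suc k) * inv (suc k) * b ≡ ι (p ^ k) * inv (suc k) * (ι p * b)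
  extract-p₁ k b = trans (cong (λ n → ι n * inv (suc k) * b) (sym (ℕₚ.*-identityʳ (p ^ suc k))))
    (trans (extract-p 1 k b) (*-identityʳ _))

  Sum-integral : ∀ n {f} → (∀ i → i < n → Integral (f i)) → Integral (Sum n f)
  Sum-integral n h = ord-integral (ord-Sum n λ i i<n → ord≥0 (h i i<n))

  Integral-- : ∀ {q r} → Integral q → Integral r → Integral (q - r)
  Integral-- qi ri = Integral-+ qi (Integral-neg ri)

  P-integral : ∀ N r → Integral (P N r)
  P-integral N r = Sum-integral N λ i _ → Integral-ι (i ^ r)

  r∸1+k<r : ∀ {k r} → k < r → r ∸ suc k < r
  r∸1+k<r k<r = ℕₚ.∸-monoʳ-< (s≤s z≤n) k<r

  -- Strong induction with N = p: each lower term contains p^(k+1)/(k+2), which is integral, times p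
  -- B at a smaller index.
  pB-integral : ∀ r → Integral (ι p * B r)
  pB-integral = <-rec _ λ r pB → subst Integral (sym (faulhaber-leading p r))
    (Integral-- (P-integral p r) (Sum-integral r λ k k<r →
      Integral-* (Integral-ι (r C suc k)) (subst Integral (sym (extract-p₁ (suc k) (B (r ∸ suc k))))
        (Integral-* (p^t/k-integral (suc k) (2 ℕ.+ k)
          (ℕₚ.≤-<-trans (ℕₚ.m≤m+n (2 ℕ.+ k) (2 ℕ.+ k)) (n+n<p^n (2 ℕ.+ k))))
          (pB (r∸1+k<r k<r))))))

  -- In the same splitting 2 + k < p^(k+1) leaves at most p^k in the denominator, so p^(k+1)/(k+2)
  -- keeps a factor p.
  pB≡P : ∀ r → ordₚ ι p * B r - P p r ≥ 1
  pB≡P r = ord-resp (trans (neg-sub (P p r) (Sum r (lowerTerm p r)))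
    (cong (_- P p r) (sym (faulhaber-leading p r))))
    (ord-neg (ord-Sum r λ k k<r → ord-*ˡ (Integral-ι (r C suc k))
      (ord-resp (sym (extract-p₁ (suc k) (B (r ∸ suc k))))
        (ord-*ʳ (ord-p^/k 1 k (2 ℕ.+ k) (2+n<p^[1+n] k)) (pB-integral (r ∸ suc k))))))
    where
    neg-sub : ∀ x s → - s ≡ x - s - x
    neg-sub = solve-∀ ℚ-ring

  -- With N = 1 the denominators k + 2 are at most r + 1 < p, so the recursion never divides by p.
  B-integral-below : ∀ r → suc r < p → Integral (B r)
  B-integral-below = <-rec _ λ r Bi 1+r<p → subst Integral
    (trans (sym (faulhaber-leading 1 r)) (*-identityˡ (B r)))
    (Integral-- (P-integral 1 r) (Sum-integral r λ k k<r →
      Integral-* (Integral-ι (r C suc k)) (Integral-* (Integral-*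
        (Integral-ι (1 ^ (2 ℕ.+ k))) (Integral-inv (p∤< (ℕₚ.≤-<-trans (s≤s k<r) 1+r<p))))
        (Bi (r∸1+k<r k<r) (ℕₚ.<-trans (s≤s (r∸1+k<r k<r)) 1+r<p)))))

  p₃ : ℕ
  p₃ = p ∸ 3

  p≡3+p₃ : p ≡ 3 ℕ.+ p₃
  p≡3+p₃ = sym (ℕₚ.m+[n∸m]≡n (ℕₚ.≤-trans (s≤s (s≤s (s≤s z≤n))) 5≤p))

  P-p₃ : ordₚ P p p₃ ≥ 1
  P-p₃ = ord-resp (cancel (P p p₃) (ι p * B p₃))
    (ord-- (ord-*ʳ (ord-∣ (divides 1 (sym (ℕₚ.*-identityˡ p))))
        (B-integral-below p₃ (subst (suc p₃ <_) (sym p≡3+p₃) (s≤s (s≤s (ℕₚ.n≤1+n p₃))))))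
      (pB≡P p₃))
    where
    cancel : ∀ x y → y - (y - x) ≡ x
    cancel = solve-∀ ℚ-ring

  p∤below : ∀ {i} .{{_ : NonZero i}} → i < p → p ∤ i
  p∤below {i} i<p p∣i = ℕₚ.<⇒≱ i<p (∣⇒≤ p∣i)

  Sum-- : ∀ n f g → Sum n (λ i → f i - g i) ≡ Sum n f - Sum n g
  Sum-- zero f g = refl
  Sum-- (suc n) f g = trans (cong (f 0 - g 0 +_) (Sum-- n (f ∘ suc) (g ∘ suc)))
    (regroup (f 0) (g 0) (Sum n (f ∘ suc)) (Sum n (g ∘ suc)))
    where
    regroup : ∀ a b c d → a - b + (c - d) ≡ a + c - (b + d)
    regroup = solve-∀ ℚ-ring

  -- Fermat's theorem lowers the exponent for i prime to p. A positive `r` makes the summand i = 0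
  -- vanish on both sides, which 0 ^ 0 = 1 would spoil.
  P-fermat : ∀ n r .{{_ : NonZero r}} → ordₚ P p ((p ∸ 1) ℕ.* n ℕ.+ r) - P p r ≥ 1
  P-fermat n r = ord-resp (Sum-- p (λ i → ι (i ^ (M ℕ.+ r))) (λ i → ι (i ^ r))) (ord-Sum p term)
    where
    M = (p ∸ 1) ℕ.* n
    0^ : ∀ r .{{_ : NonZero r}} → 0 ^ r ≡ 0
    0^ (suc r) = refl
    instance
      M+r≢0 : NonZero (M ℕ.+ r)
      M+r≢0 = ℕ.>-nonZero (ℕₚ.<-≤-trans (ℕ.>-nonZero⁻¹ r) (ℕₚ.m≤n+m r M))
    term : ∀ i → i < p → ordₚ ι (i ^ (M ℕ.+ r)) - ι (i ^ r) ≥ 1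
    term zero    _   = ord-resp (sym (cong₂ (λ a b → ι a - ι b) (0^ (M ℕ.+ r)) (0^ r))) (ord-0 1)
    term i@(suc _) i<p = ord-resp (begin
      (E (ι (i ^ (p ∸ 1))) n - 1ℚ) * ι (i ^ r)
        ≡⟨ cong (λ x → (x - 1ℚ) * ι (i ^ r))
          (trans (E-ι (i ^ (p ∸ 1)) n) (cong ι (ℕₚ.^-*-assoc i (p ∸ 1) n))) ⟩
      (ι (i ^ M) - 1ℚ) * ι (i ^ r)                      ≡⟨ expand (ι (i ^ M)) (ι (i ^ r)) ⟩
      ι (i ^ M) * ι (i ^ r) - ι (i ^ r)
        ≡⟨ cong (_- ι (i ^ r)) (trans (sym (ι-* (i ^ M) (i ^ r))) (cong ι (sym (ℕₚ.^-distribˡ-+-* i M r)))) ⟩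
      ι (i ^ (M ℕ.+ r)) - ι (i ^ r)                     ∎)
      (ord-*ʳ (ord-^ (Integral-ι (i ^ (p ∸ 1))) (fermat-unit (p∤below i<p)) n) (Integral-ι (i ^ r)))
      where
      expand : ∀ a b → (a - 1ℚ) * b ≡ a * b - b
      expand = solve-∀ ℚ-ring

  -- The index is p (p ∸ 1) ∸ 2, which is congruent to p ∸ 3 modulo p ∸ 1.
  B-wolstenholme : Integral (B ((p ∸ 1) ℕ.* (p ∸ 1) ℕ.+ p₃))
  B-wolstenholme = ord-integral (subst (λ q → ord≥ 0 q) (begin
      inv (p ^ 1) * (ι p * b)        ≡⟨ cong (λ n → inv n * (ι p * b)) (ℕₚ.^-identityʳ p) ⟩
      inv p * (ι p * b)              ≡⟨ *-assoc (inv p) (ι p) b ⟨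
      inv p * ι p * b                ≡⟨ cong (_* b) (trans (*-comm (inv p) (ι p)) (ι*inv p)) ⟩
      1ℚ * b                         ≡⟨ *-identityˡ b ⟩
      b                              ∎)
    -- Modulo p, p b ≡ `P p r` ≡ `P p p₃` ≡ 0; dividing by p leaves b integral.
    (ord-/p^ 1 (ord-resp (cancel (ι p * b) (P p r) (P p p₃))
      (ord-+ (ord-+ (pB≡P r) (P-fermat (p ∸ 1) p₃ {{p₃≢0}})) P-p₃))))
    where
    r = (p ∸ 1) ℕ.* (p ∸ 1) ℕ.+ p₃
    b = B r
    cancel : ∀ x y z → x - y + (y - z) + z ≡ x
    cancel = solve-∀ ℚ-ring
    p₃≢0 : NonZero p₃
    p₃≢0 = ℕ.>-nonZero (ℕₚ.m<n⇒0<n∸m (ℕₚ.≤-trans (s≤s (s≤s (s≤s (s≤s z≤n)))) 5≤p))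

  -- Harmonic sums

  H≡Sum : ∀ N → H N ≡ Sum N (λ i → inv (suc i))
  H≡Sum N = Σ≡Sum 1 N (λ i → 1ℚ ÷ℕ i)

  Hᵖ : ℕ → ℚ
  Hᵖ x = H (p ℕ.* x) - H x * inv p

  Sum-block : ∀ f x → Sum (p ℕ.* suc x) f ≡ Sum (p ℕ.* x) f + Sum p (λ i → f (p ℕ.* x ℕ.+ i))
  Sum-block f x = trans (cong (λ n → Sum n f) (trans (ℕₚ.*-suc p x) (ℕₚ.+-comm p (p ℕ.* x))))
    (Sum-split (p ℕ.* x) p f)

  p₁ : ℕ
  p₁ = p ∸ 1

  -- The last reciprocal of the block, 1/(p(x+1)), is exactly the increment of H(x)/p.
  Hᵖ-suc : ∀ x → Hᵖ (suc x) ≡ Hᵖ x + Sum p₁ (λ i → inv (p ℕ.* x ℕ.+ suc i))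
  Hᵖ-suc x = begin
    H (p ℕ.* suc x) - H (suc x) * inv p
      ≡⟨ cong₂ (λ a b → a - b * inv p) numer
        (trans (H≡Sum (suc x)) (trans (Sum-suc x _) (cong (_+ inv (suc x)) (sym (H≡Sum x))))) ⟩
    H (p ℕ.* x) + (s + inv (p ℕ.* suc x)) - (H x + inv (suc x)) * inv p
      ≡⟨ cong (λ y → H (p ℕ.* x) + (s + y) - (H x + inv (suc x)) * inv p) (inv-* p (suc x)) ⟩
    H (p ℕ.* x) + (s + inv p * inv (suc x)) - (H x + inv (suc x)) * inv p
      ≡⟨ cancel (H (p ℕ.* x)) s (inv p) (inv (suc x)) (H x) ⟩
    Hᵖ x + s ∎
    where
    s = Sum p₁ (λ i → inv (p ℕ.* x ℕ.+ suc i))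
    cancel : ∀ a s i j b → a + (s + i * j) - (b + j) * i ≡ a - b * i + s
    cancel = solve-∀ ℚ-ring
    last-index : suc (p ℕ.* x ℕ.+ p₁) ≡ p ℕ.* suc x
    last-index = begin
      suc (p ℕ.* x ℕ.+ p₁)       ≡⟨ ℕₚ.+-suc (p ℕ.* x) p₁ ⟨
      p ℕ.* x ℕ.+ suc p₁         ≡⟨ cong (p ℕ.* x ℕ.+_) p≡1+[p∸1] ⟨
      p ℕ.* x ℕ.+ p              ≡⟨ trans (ℕₚ.*-suc p x) (ℕₚ.+-comm p (p ℕ.* x)) ⟨
      p ℕ.* suc x                ∎
    numer : H (p ℕ.* suc x) ≡ H (p ℕ.* x) + (s + inv (p ℕ.* suc x))
    numer = begin
      H (p ℕ.* suc x)
        ≡⟨ H≡Sum (p ℕ.* suc x) ⟩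
      Sum (p ℕ.* suc x) (λ i → inv (suc i))
        ≡⟨ Sum-block (λ i → inv (suc i)) x ⟩
      Sum (p ℕ.* x) (λ i → inv (suc i)) + Sum p (λ i → inv (suc (p ℕ.* x ℕ.+ i)))
        ≡⟨ cong₂ _+_ (sym (H≡Sum (p ℕ.* x))) (cong (λ n → Sum n (λ i → inv (suc (p ℕ.* x ℕ.+ i)))) p≡1+[p∸1]) ⟩
      H (p ℕ.* x) + Sum (suc p₁) (λ i → inv (suc (p ℕ.* x ℕ.+ i)))
        ≡⟨ cong (H (p ℕ.* x) +_) (Sum-suc p₁ _) ⟩
      H (p ℕ.* x) + (Sum p₁ (λ i → inv (suc (p ℕ.* x ℕ.+ i))) + inv (suc (p ℕ.* x ℕ.+ p₁)))
        ≡⟨ cong₂ (λ a n → H (p ℕ.* x) + (a + inv n))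
          (Sum-cong p₁ (λ i _ → cong inv (sym (ℕₚ.+-suc (p ℕ.* x) i)))) last-index ⟩
      H (p ℕ.* x) + (s + inv (p ℕ.* suc x))                                   ∎

  -- Power sums start at i = 0, so here the multiple of p opens the block, whereas in H it closes
  -- it.
  P-block : ∀ r x → P (p ℕ.* suc x) r
    ≡ P (p ℕ.* x) r + (ι ((p ℕ.* x) ^ r) + Sum p₁ (λ i → ι ((p ℕ.* x ℕ.+ suc i) ^ r)))
  P-block r x = begin
    P (p ℕ.* suc x) r
      ≡⟨ Sum-block (λ i → ι (i ^ r)) x ⟩
    P (p ℕ.* x) r + Sum p f
      ≡⟨ cong (λ n → P (p ℕ.* x) r + Sum n f) p≡1+[p∸1] ⟩
    P (p ℕ.* x) r + (f 0 + Sum p₁ (f ∘ suc))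
      ≡⟨ cong (λ n → P (p ℕ.* x) r + (ι (n ^ r) + Sum p₁ (f ∘ suc))) (ℕₚ.+-identityʳ (p ℕ.* x)) ⟩
    P (p ℕ.* x) r + (ι ((p ℕ.* x) ^ r) + Sum p₁ (f ∘ suc))              ∎
    where
    f = λ i → ι ((p ℕ.* x ℕ.+ i) ^ r)

  module _ (h : ℕ) (r : ℕ) (1+r≡φ : suc r ≡ p ^ h ℕ.* (p ∸ 1)) (h<r : h < r) where

    inv≡^ : ∀ {i} → p ∤ i → ordₚ inv i - ι (i ^ r) ≥ suc h
    inv≡^ {i} p∤i = ord-resp (begin
      - inv i * (ι (i ^ (p ^ h ℕ.* (p ∸ 1))) - 1ℚ)
        ≡⟨ cong (λ n → - inv i * (ι (i ^ n) - 1ℚ)) 1+r≡φ ⟨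
      - inv i * (ι (i ℕ.* i ^ r) - 1ℚ)
        ≡⟨ cong (λ y → - inv i * (y - 1ℚ)) (ι-* i (i ^ r)) ⟩
      - inv i * (ι i * ι (i ^ r) - 1ℚ)                  ≡⟨ regroup (inv i) (ι i) (ι (i ^ r)) ⟩
      inv i - ι i * inv i * ι (i ^ r)
        ≡⟨ cong (λ y → inv i - y * ι (i ^ r)) (ι*inv i {{p∤⇒nonZero p∤i}}) ⟩
      inv i - 1ℚ * ι (i ^ r)
        ≡⟨ cong (λ y → inv i - y) (*-identityˡ (ι (i ^ r))) ⟩
      inv i - ι (i ^ r)                                 ∎)
      (ord-*ˡ (Integral-neg (Integral-inv p∤i)) (euler p∤i h))
      where
      regroup : ∀ a b c → - a * (b * c - 1ℚ) ≡ a - b * a * c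
      regroup = solve-∀ ℚ-ring

    Hᵖ≡P : ∀ x → ordₚ Hᵖ x - P (p ℕ.* x) r ≥ suc h
    Hᵖ≡P zero = ord-resp (sym (cong (λ n → H n - 0ℚ * inv p - P n r) (ℕₚ.*-zeroʳ p)))
      (ord-resp (sym (trans (cong (λ y → 0ℚ - y - 0ℚ) (*-zeroˡ (inv p))) refl)) (ord-0 (suc h)))
    Hᵖ≡P (suc x) = ord-resp (begin
      Hᵖ x - P (p ℕ.* x) r + (Sum p₁ (λ i → f i - g i) - ι ((p ℕ.* x) ^ r))
        ≡⟨ cong (λ y → Hᵖ x - P (p ℕ.* x) r + (y - ι ((p ℕ.* x) ^ r))) (Sum-- p₁ f g) ⟩
      Hᵖ x - P (p ℕ.* x) r + (Sum p₁ f - Sum p₁ g - ι ((p ℕ.* x) ^ r))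
        ≡⟨ regroup (Hᵖ x) (P (p ℕ.* x) r) (Sum p₁ f) (Sum p₁ g) (ι ((p ℕ.* x) ^ r)) ⟩
      Hᵖ x + Sum p₁ f - (P (p ℕ.* x) r + (ι ((p ℕ.* x) ^ r) + Sum p₁ g))
        ≡⟨ cong₂ _-_ (Hᵖ-suc x) (P-block r x) ⟨
      Hᵖ (suc x) - P (p ℕ.* suc x) r ∎)
      (ord-+ (Hᵖ≡P x) (ord-- (ord-Sum p₁ λ i i<p₁ → inv≡^ (p∤px+ i i<p₁)) multiple))
      where
      f = λ i → inv (p ℕ.* x ℕ.+ suc i)
      g = λ i → ι ((p ℕ.* x ℕ.+ suc i) ^ r)
      regroup : ∀ a b c d e → a - b + (c - d - e) ≡ a + c - (b + (e + d))
      regroup = solve-∀ ℚ-ring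
      p∤px+ : ∀ i → i < p₁ → p ∤ p ℕ.* x ℕ.+ suc i
      p∤px+ i i<p₁ p∣ = p∤< (subst (suc i <_) (sym p≡1+[p∸1]) (s≤s i<p₁)) (∣m+n∣m⇒∣n p∣ (m∣m*n x))
      -- The power sum contains px, which has no counterpart in `Hᵖ`; r ≥ h + 1 makes its r-th power
      -- negligible.
      multiple : ordₚ ι ((p ℕ.* x) ^ r) ≥ suc h
      multiple = ord-≤ h<r (ord-resp (trans (sym (ι-* (p ^ r) (x ^ r))) (cong ι (sym (^-distribʳ-* p x r))))
        (ord-*ʳ (ord-ι^ r) (Integral-ι (x ^ r))))

  -- Truncation of Faulhaber's formula modulo a power of p

  faulhaberTerm : ℕ → ℕ → ℕ → ℚ
  faulhaberTerm N r k = ι (r C k) * (ι (N ^ suc k) * inv (suc k) * B (r ∸ k))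

  Sum-pairs : ∀ h f → Sum (h ℕ.+ h) f ≡ Sum h (λ k → f (k ℕ.+ k) + f (suc (k ℕ.+ k)))
  Sum-pairs zero    f = refl
  Sum-pairs (suc h) f = begin
    f 0 + Sum (h ℕ.+ suc h) (f ∘ suc)
      ≡⟨ cong (λ n → f 0 + Sum n (f ∘ suc)) (ℕₚ.+-suc h h) ⟩
    f 0 + (f 1 + Sum (h ℕ.+ h) (f ∘ suc ∘ suc))        ≡⟨ +-assoc (f 0) (f 1) _ ⟨
    f 0 + f 1 + Sum (h ℕ.+ h) (f ∘ suc ∘ suc)
      ≡⟨ cong (f 0 + f 1 +_) (Sum-pairs h (f ∘ suc ∘ suc)) ⟩
    f 0 + f 1 + Sum h (λ k → f (2 ℕ.+ (k ℕ.+ k)) + f (3 ℕ.+ (k ℕ.+ k)))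
      ≡⟨ cong (f 0 + f 1 +_) (Sum-cong h λ k _ → cong (λ n → f (suc n) + f (2 ℕ.+ n)) (sym (ℕₚ.+-suc k k))) ⟩
    f 0 + f 1 + Sum h (λ k → f (suc k ℕ.+ suc k) + f (suc (suc k ℕ.+ suc k))) ∎

  -- The terms with an even index carry a Bernoulli number with an odd index ≥ 3.
  P-truncate : ∀ h w x → let r = 3 ℕ.+ ((h ℕ.+ w) ℕ.+ (h ℕ.+ w)) in
    ordₚ P (p ℕ.* x) r - Sum h (λ k → faulhaberTerm (p ℕ.* x) r (suc (k ℕ.+ k))) ≥ suc h
  P-truncate h w x = ord-resp split (ord-Sum R λ j _ → tail j)
    where
    r = 3 ℕ.+ ((h ℕ.+ w) ℕ.+ (h ℕ.+ w))
    N = p ℕ.* x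
    -- The r + 1 terms are the first 2h + 1 and these `R`. The cut lies after the even index 2h,
    -- whose term vanishes too.
    R = 3 ℕ.+ (w ℕ.+ w)
    f = faulhaberTerm N r
    even-vanishes : ∀ k → k ≤ h → f (k ℕ.+ k) ≡ 0ℚ
    even-vanishes k k≤h = begin
      c * (e * B (r ∸ (k ℕ.+ k)))           ≡⟨ cong (λ n → c * (e * B n)) index ⟩
      c * (e * B (3 ℕ.+ (d ℕ.+ d)))         ≡⟨ cong (λ b → c * (e * b)) (B-odd d) ⟩
      c * (e * 0ℚ)                          ≡⟨ trans (cong (c *_) (*-zeroʳ e)) (*-zeroʳ c) ⟩
      0ℚ                                    ∎
      where
      c = ι (r C (k ℕ.+ k))
      e = ι (N ^ suc (k ℕ.+ k)) * inv (suc (k ℕ.+ k))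
      d = (h ∸ k) ℕ.+ w
      regroup : ∀ k d w → 3 ℕ.+ ((k ℕ.+ d ℕ.+ w) ℕ.+ (k ℕ.+ d ℕ.+ w))
        ≡ k ℕ.+ k ℕ.+ (3 ℕ.+ ((d ℕ.+ w) ℕ.+ (d ℕ.+ w)))
      regroup = solve-∀ℕ
      index : r ∸ (k ℕ.+ k) ≡ 3 ℕ.+ (d ℕ.+ d)
      index = begin
        r ∸ (k ℕ.+ k)
          ≡⟨ cong (λ y → 3 ℕ.+ ((y ℕ.+ w) ℕ.+ (y ℕ.+ w)) ∸ (k ℕ.+ k)) (ℕₚ.m+[n∸m]≡n k≤h) ⟨
        3 ℕ.+ ((k ℕ.+ (h ∸ k) ℕ.+ w) ℕ.+ (k ℕ.+ (h ∸ k) ℕ.+ w)) ∸ (k ℕ.+ k)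
          ≡⟨ cong (_∸ (k ℕ.+ k)) (regroup k (h ∸ k) w) ⟩
        k ℕ.+ k ℕ.+ (3 ℕ.+ (d ℕ.+ d)) ∸ (k ℕ.+ k)
          ≡⟨ ℕₚ.m+n∸m≡n (k ℕ.+ k) (3 ℕ.+ (d ℕ.+ d)) ⟩
        3 ℕ.+ (d ℕ.+ d)    ∎
    main = Sum h (λ k → f (suc (k ℕ.+ k)))
    rest = Sum R (λ j → f (suc (h ℕ.+ h) ℕ.+ j))
    split : rest ≡ P N r - main
    split = sym (begin
      P N r - main                                          ≡⟨ cong (_- main) (faulhaber N r) ⟩
      Sum (suc r) f - main
        ≡⟨ cong (λ n → Sum n f - main) (length h w) ⟩
      Sum (suc (h ℕ.+ h) ℕ.+ R) f - main
        ≡⟨ cong (_- main) (Sum-split (suc (h ℕ.+ h)) R f) ⟩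
      Sum (suc (h ℕ.+ h)) f + rest - main
        ≡⟨ cong (λ y → y + rest - main) (Sum-suc (h ℕ.+ h) f) ⟩
      Sum (h ℕ.+ h) f + f (h ℕ.+ h) + rest - main
        ≡⟨ cong₂ (λ y z → y + z + rest - main)
          (trans (Sum-pairs h f) (Sum-cong h λ k k<h → trans (cong (_+ f (suc (k ℕ.+ k))) (even-vanishes k (ℕₚ.<⇒≤ k<h))) (+-identityˡ _)))
          (even-vanishes h ℕₚ.≤-refl) ⟩
      main + 0ℚ + rest - main                               ≡⟨ cancel main rest ⟩
      rest                                                  ∎)
      where
      cancel : ∀ m r → m + 0ℚ + r - m ≡ r
      cancel = solve-∀ ℚ-ring
      length : ∀ h w → suc (3 ℕ.+ ((h ℕ.+ w) ℕ.+ (h ℕ.+ w))) ≡ suc (h ℕ.+ h) ℕ.+ (3 ℕ.+ (w ℕ.+ w))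
      length = solve-∀ℕ
    -- With k = 2h + 1 + j, the p^k left by `extract-p` splits into p^(h+1), which is kept, and
    -- p^(h+j), which absorbs k + 1 ≤ 2(h + j + 1) < p^(h+j+1).
    tail : ∀ j → ordₚ f (suc (h ℕ.+ h) ℕ.+ j) ≥ suc h
    tail j = ord-*ˡ (Integral-ι (r C k)) (ord-resp (sym (trans
        (cong (λ n → ι n * inv (suc k) * B (r ∸ k)) (^-distribʳ-* p x (suc k)))
        (extract-p (x ^ suc k) k (B (r ∸ k)))))
      (ord-*ʳ (ord-*ʳ
        (subst (λ n → ordₚ ι (p ^ n) * inv (suc k) ≥ suc h) (exponent h j)
          (ord-p^/k (suc h) (h ℕ.+ j) (suc k) small))
        (pB-integral (r ∸ k))) (Integral-ι (x ^ suc k))))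
      where
      k = suc (h ℕ.+ h) ℕ.+ j
      exponent : ∀ h j → suc h ℕ.+ (h ℕ.+ j) ≡ suc (h ℕ.+ h) ℕ.+ j
      exponent = solve-∀ℕ
      double : ∀ h j → suc (suc (h ℕ.+ h) ℕ.+ j) ℕ.+ j ≡ suc (h ℕ.+ j) ℕ.+ suc (h ℕ.+ j)
      double = solve-∀ℕ
      small : suc k < p ^ suc (h ℕ.+ j)
      small = ℕₚ.≤-<-trans (ℕₚ.m≤m+n (suc k) j)
        (subst (_< p ^ suc (h ℕ.+ j)) (sym (double h j)) (n+n<p^n (suc (h ℕ.+ j))))

  -- Parity and size of the exponent

  parity : ∀ n → ∃ λ e → n ≡ e ℕ.+ e ⊎ n ≡ suc (e ℕ.+ e)
  parity zero    = 0 , inj₁ refl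
  parity (suc n) with parity n
  ... | e , inj₁ refl = e , inj₂ refl
  ... | e , inj₂ refl = suc e , inj₁ (cong suc (sym (ℕₚ.+-suc e e)))

  2∤p : 2 ∤ p
  2∤p 2∣p with prime⇒irreducible p-prime 2∣p
  ... | inj₂ refl = contradiction 5≤p λ { (s≤s (s≤s ())) }

  p-odd : ∃ λ e → p ≡ suc (e ℕ.+ e)
  p-odd with parity p
  ... | e , inj₁ p≡e+e = contradiction (divides e (trans p≡e+e (twice e))) 2∤p
    where
    twice : ∀ e → e ℕ.+ e ≡ e ℕ.* 2
    twice = solve-∀ℕ
  ... | e , inj₂ p≡    = e , p≡

  -- Euler's totient of p^(h+1), not of p^h.
  φ : ℕ → ℕ
  φ h = p ^ h ℕ.* (p ∸ 1)

  -- Even because p - 1 = 2e, and large because p^h > h and e ≥ 2, the latter from p ≥ 5. So φ h - 1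
  -- fits `P-truncate`, and the truncated subtraction of 2k ≤ 2h in the theorem is a true one.
  φ-shape : ∀ h → ∃ λ w → φ h ≡ 4 ℕ.+ ((h ℕ.+ w) ℕ.+ (h ℕ.+ w))
  φ-shape h with p-odd
  ... | e , p≡1+e+e = w , (begin
    p ^ h ℕ.* (p ∸ 1)                    ≡⟨ cong (λ n → p ^ h ℕ.* (n ∸ 1)) p≡1+e+e ⟩
    p ^ h ℕ.* (e ℕ.+ e)                  ≡⟨ ℕₚ.*-distribˡ-+ (p ^ h) e e ⟩
    u ℕ.+ u                              ≡⟨ cong (λ n → n ℕ.+ n) (ℕₚ.m+[n∸m]≡n 2+h≤u) ⟨
    (2 ℕ.+ h ℕ.+ w) ℕ.+ (2 ℕ.+ h ℕ.+ w)  ≡⟨ regroup h w ⟩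
    4 ℕ.+ ((h ℕ.+ w) ℕ.+ (h ℕ.+ w))      ∎)
    where
    u = p ^ h ℕ.* e
    w = u ∸ (2 ℕ.+ h)
    regroup : ∀ h w → (2 ℕ.+ h ℕ.+ w) ℕ.+ (2 ℕ.+ h ℕ.+ w) ≡ 4 ℕ.+ ((h ℕ.+ w) ℕ.+ (h ℕ.+ w))
    regroup = solve-∀ℕ
    2≤ : ∀ e → 4 ≤ e ℕ.+ e → 2 ≤ e
    2≤ (suc (suc e)) _ = s≤s (s≤s z≤n)
    2≤ (suc zero) (s≤s (s≤s ()))
    2≤e : 2 ≤ e
    2≤e = 2≤ e (ℕₚ.≤-pred (subst (5 ≤_) p≡1+e+e 5≤p))
    2+h≤u : 2 ℕ.+ h ≤ u
    2+h≤u = ℕₚ.≤-trans (ℕₚ.≤-trans (s≤s (s≤s (ℕₚ.m≤m+n h h)))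
      (subst (_≤ p ^ h ℕ.* 2) (regroup₂ h) (ℕₚ.*-monoˡ-≤ 2 (ℕₚ.≤-<-trans (ℕₚ.m≤m+n h h) (n+n<p^n h)))))
      (ℕₚ.*-monoʳ-≤ (p ^ h) 2≤e)
      where
      regroup₂ : ∀ h → suc h ℕ.* 2 ≡ 2 ℕ.+ (h ℕ.+ h)
      regroup₂ = solve-∀ℕ

  -- The theorem's summand at k + 1 without its factor 1/p^h, which returns when `Hᵖ` is divided by
  -- p^h.
  bernoulliTerm : ℕ → ℕ → ℕ → ℚ
  bernoulliTerm M N k = B (M ∸ 2 ℕ.* suc k) * inv (2 ℕ.* suc k)
    * ι ((M ∸ 1) C (2 ℕ.* suc k ∸ 1)) * ι (N ^ (2 ℕ.* suc k))

  bernoulliTerm≡ : ∀ r N k → bernoulliTerm (suc r) N k ≡ faulhaberTerm N r (suc (k ℕ.+ k))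
  bernoulliTerm≡ r N k = trans
    (cong (λ i → B (suc r ∸ i) * inv i * ι (r C (i ∸ 1)) * ι (N ^ i)) (2*suc k))
    (regroup (B (r ∸ suc (k ℕ.+ k))) (inv (2 ℕ.+ (k ℕ.+ k))) (ι (r C suc (k ℕ.+ k))) (ι (N ^ (2 ℕ.+ (k ℕ.+ k)))))
    where
    2*suc : ∀ k → 2 ℕ.* suc k ≡ 2 ℕ.+ (k ℕ.+ k)
    2*suc = solve-∀ℕ
    regroup : ∀ b i c n → b * i * c * n ≡ c * (n * i * b)
    regroup = solve-∀ ℚ-ring

  Hᵖ≡bernoulli : ∀ h x → ordₚ Hᵖ x - Sum h (bernoulliTerm (φ h) (p ℕ.* x)) ≥ suc h
  Hᵖ≡bernoulli h x with φ-shape h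
  ... | w , φ≡ = ord-trans (Hᵖ x) (P (p ℕ.* x) r) _ (Hᵖ≡P h r (sym φ≡) h<r x)
    (ord-resp (cong (λ y → P (p ℕ.* x) r - y) (trans (Sum-cong h λ k _ → sym (bernoulliTerm≡ r (p ℕ.* x) k))
        (cong (λ M → Sum h (bernoulliTerm M (p ℕ.* x))) (sym φ≡))))
      (P-truncate h w x))
    where
    r = 3 ℕ.+ ((h ℕ.+ w) ℕ.+ (h ℕ.+ w))
    h<r : h < r
    h<r = s≤s (ℕₚ.≤-trans (ℕₚ.≤-trans (ℕₚ.m≤m+n h w) (ℕₚ.m≤m+n (h ℕ.+ w) (h ℕ.+ w))) (ℕₚ.m≤n+m _ 2))

  -- At x = 1 this is H(p-1) ≡ 0 modulo p². For h = 1 the only Bernoulli term is (px)² times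
  -- integral factors.
  wolstenholme : ∀ x → ordₚ Hᵖ x ≥ 2
  wolstenholme x = ord-resp (cancel (Hᵖ x) t)
    (ord-+ (Hᵖ≡bernoulli 1 x) (ord-+ (ord-*ˡ (Integral-* (Integral-* B-integral (Integral-inv 2-unit))
      (Integral-ι ((φ 1 ∸ 1) C 1))) square) (ord-0 2)))
    where
    t = Sum 1 (bernoulliTerm (φ 1) (p ℕ.* x))
    cancel : ∀ x t → x - t + t ≡ x
    cancel = solve-∀ ℚ-ring
    2-unit : p ∤ 2
    2-unit = p∤< (ℕₚ.≤-trans (s≤s (s≤s (s≤s z≤n))) 5≤p)
    expand : ∀ q → (3 ℕ.+ q) ℕ.* 1 ℕ.* (2 ℕ.+ q) ≡ 2 ℕ.+ ((2 ℕ.+ q) ℕ.* (2 ℕ.+ q) ℕ.+ q)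
    expand = solve-∀ℕ
    -- Stated for a variable `n`, so that 3 + q can be substituted and the subtractions compute.
    index : ∀ {n q} → n ≡ 3 ℕ.+ q → n ^ 1 ℕ.* (n ∸ 1) ∸ 2 ≡ (n ∸ 1) ℕ.* (n ∸ 1) ℕ.+ q
    index {q = q} refl = cong (_∸ 2) (expand q)
    B-integral : Integral (B (φ 1 ∸ 2))
    B-integral = subst (λ n → Integral (B n)) (sym (index p≡3+p₃)) B-wolstenholme
    square : ordₚ ι ((p ℕ.* x) ^ 2) ≥ 2
    square = ord-resp (trans (sym (ι-* (p ^ 2) (x ^ 2))) (cong ι (sym (^-distribʳ-* p x 2))))
      (ord-*ʳ (ord-ι^ 2) (Integral-ι (x ^ 2)))

  -- Telescoping in m

  p^suc* : ∀ e n → p ^ suc e ℕ.* n ≡ p ^ e ℕ.* (p ℕ.* n)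
  p^suc* e n = trans (cong (ℕ._* n) (ℕₚ.*-comm p (p ^ e))) (ℕₚ.*-assoc (p ^ e) p n)

  defect : ℕ → ℕ → ℚ
  defect m n = H (p ^ m ℕ.* n) - H n * inv (p ^ m)

  -- H(pn)/p^m is subtracted and added. Since n becomes pn, the induction on m must hold for all n
  -- at once.
  defect-suc : ∀ m n → defect (suc m) n ≡ defect m (p ℕ.* n) + inv (p ^ m) * Hᵖ n
  defect-suc m n = begin
    H (p ^ suc m ℕ.* n) - H n * inv (p ^ suc m)
      ≡⟨ cong₂ (λ k y → H k - H n * y) (p^suc* m n) (inv-* p (p ^ m) {{p≢0}} {{p^≢0 m}}) ⟩
    H (p ^ m ℕ.* (p ℕ.* n)) - H n * (inv p * inv (p ^ m))
      ≡⟨ regroup (H (p ^ m ℕ.* (p ℕ.* n))) (H n) (inv p) (inv (p ^ m)) (H (p ℕ.* n)) ⟩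
    defect m (p ℕ.* n) + inv (p ^ m) * Hᵖ n ∎
    where
    regroup : ∀ a b i j c → a - b * (i * j) ≡ a - c * j + j * (c - b * i)
    regroup = solve-∀ ℚ-ring

  correction : ℕ → ℕ → ℕ → ℚ
  correction m n j = inv (p ^ (2 ℕ.+ j)) * Sum (2 ℕ.+ j) (bernoulliTerm (φ (2 ℕ.+ j)) (p ^ (m ∸ (2 ℕ.+ j)) ℕ.* n))

  -- The length is the one to which `Σ[ 2 ⋯ m ∸ 1 ]` unfolds; it is 0 for m ≤ 2.
  corrections : ℕ → ℕ → ℚ
  corrections m n = Sum (suc (m ∸ 1) ∸ 2) (correction m n)

  -- Because p^(m+1-h) n = p^(m-h) (pn), the earlier terms are reproduced exactly under n ↦ pn, and
  -- only h = m = 2 + j is new.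
  corrections-suc : ∀ j n → corrections (3 ℕ.+ j) n
    ≡ corrections (2 ℕ.+ j) (p ℕ.* n) + inv (p ^ (2 ℕ.+ j)) * Sum (2 ℕ.+ j) (bernoulliTerm (φ (2 ℕ.+ j)) (p ℕ.* n))
  corrections-suc j n = trans (Sum-suc j (correction (3 ℕ.+ j) n)) (cong₂ _+_ (Sum-cong j earlier) latest)
    where
    at : ℕ → ℕ → ℚ
    at i N = inv (p ^ (2 ℕ.+ i)) * Sum (2 ℕ.+ i) (bernoulliTerm (φ (2 ℕ.+ i)) N)
    earlier : ∀ i → i < j → correction (3 ℕ.+ j) n i ≡ correction (2 ℕ.+ j) (p ℕ.* n) i
    earlier i i<j = cong (at i) (trans (cong (λ e → p ^ e ℕ.* n) (ℕₚ.+-∸-assoc 1 (ℕₚ.<⇒≤ i<j)))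
      (p^suc* (j ∸ i) n))
    latest : correction (3 ℕ.+ j) n j ≡ at j (p ℕ.* n)
    latest = cong (at j) (trans (cong (λ e → p ^ e ℕ.* n) (ℕₚ.m+n∸n≡m 1 j)) (cong (ℕ._* n) (ℕₚ.^-identityʳ p)))

  -- The step from m to m + 1 adds `Hᵖ n` / p^m, so `Hᵖ n` must be known modulo p^(m+1);
  -- `Hᵖ≡bernoulli` at h = m has this precision.
  defect≡corrections : ∀ m n → ordₚ defect m n - corrections m n ≥ 1
  defect≡corrections zero n = ord-resp (sym (begin
    H (1 ℕ.* n) - H n * inv 1 - 0ℚ     ≡⟨ cong (λ k → H k - H n * inv 1 - 0ℚ) (ℕₚ.*-identityˡ n) ⟩
    H n - H n * 1ℚ - 0ℚ                ≡⟨ cancel (H n) ⟩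
    0ℚ                                 ∎)) (ord-0 1)
    where
    cancel : ∀ x → x - x * 1ℚ - 0ℚ ≡ 0ℚ
    cancel = solve-∀ ℚ-ring
  defect≡corrections (suc zero) n = ord-resp (trans (regroup (defect 0 (p ℕ.* n)) _)
    (cong (_- 0ℚ) (sym (defect-suc 0 n))))
    (ord-+ (defect≡corrections 0 (p ℕ.* n)) (ord-/p^ 0 (ord-≤ (s≤s z≤n) (wolstenholme n))))
    where
    regroup : ∀ y z → y - 0ℚ + z ≡ y + z - 0ℚ
    regroup = solve-∀ ℚ-ring
  defect≡corrections (suc (suc zero)) n = ord-resp (trans (regroup (defect 1 (p ℕ.* n)) _)
    (cong (_- 0ℚ) (sym (defect-suc 1 n))))
    -- Dividing by p spends one of the two powers of p in `Hᵖ n` and leaves the other, so h = 1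
    -- contributes no correction.
    (ord-+ (defect≡corrections 1 (p ℕ.* n)) (ord-/p^ 1 (wolstenholme n)))
    where
    regroup : ∀ y z → y - 0ℚ + z ≡ y + z - 0ℚ
    regroup = solve-∀ ℚ-ring
  defect≡corrections (suc (suc (suc j))) n = ord-resp (begin
    defect m (p ℕ.* n) - corrections m (p ℕ.* n) + inv (p ^ m) * (Hᵖ n - s)
      ≡⟨ regroup (defect m (p ℕ.* n)) (corrections m (p ℕ.* n)) (inv (p ^ m)) (Hᵖ n) s ⟩
    defect m (p ℕ.* n) + inv (p ^ m) * Hᵖ n - (corrections m (p ℕ.* n) + inv (p ^ m) * s)
      ≡⟨ cong₂ _-_ (defect-suc m n) (corrections-suc j n) ⟨
    defect (suc m) n - corrections (suc m) n ∎)
    (ord-+ (defect≡corrections (suc (suc j)) (p ℕ.* n))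
      (ord-/p^ m (subst (λ t → ordₚ Hᵖ n - s ≥ t) (ℕₚ.+-comm 1 m) (Hᵖ≡bernoulli m n))))
    where
    m = 2 ℕ.+ j
    s = Sum m (bernoulliTerm (φ m) (p ℕ.* n))
    regroup : ∀ a b i c s → a - b + i * (c - s) ≡ a + i * c - (b + i * s)
    regroup = solve-∀ ℚ-ring

  -- Matching the sum in the theorem

  module _ (n m : ℕ) where

    statedTerm : ℕ → ℕ → ℚ
    statedTerm h k = ((B (p ^ h ℕ.* (p ∸ 1) ∸ 2 ℕ.* k) ÷ℕ (2 ℕ.* k ℕ.* p ^ h))
              * ι ((p ^ h ℕ.* (p ∸ 1) ∸ 1) C (2 ℕ.* k ∸ 1)))
              * ι (p ^ (2 ℕ.* k ℕ.* (m ∸ h)) ℕ.* n ^ (2 ℕ.* k))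

    -- The inner sum starts at 1, where 2k p^h is nonzero and `÷ℕ` is a genuine division.
    statedTerm≡ : ∀ h k → statedTerm h (suc k) ≡ inv (p ^ h) * bernoulliTerm (φ h) (p ^ (m ∸ h) ℕ.* n) k
    statedTerm≡ h k = begin
      (b ÷ℕ (i ℕ.* p ^ h)) * c * ι (p ^ (i ℕ.* (m ∸ h)) ℕ.* n ^ i)
        ≡⟨ cong₂ (λ y z → y * c * ι z)
          (trans (÷ℕ≡*inv b (i ℕ.* p ^ h)) (cong (b *_) (inv-* i (p ^ h) {{_}} {{p^≢0 h}}))) power ⟩
      b * (inv i * inv (p ^ h)) * c * ι ((p ^ (m ∸ h) ℕ.* n) ^ i)
        ≡⟨ regroup b (inv i) (inv (p ^ h)) c (ι ((p ^ (m ∸ h) ℕ.* n) ^ i)) ⟩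
      inv (p ^ h) * bernoulliTerm (φ h) (p ^ (m ∸ h) ℕ.* n) k ∎
      where
      i = 2 ℕ.* suc k
      b = B (φ h ∸ i)
      c = ι ((φ h ∸ 1) C (i ∸ 1))
      power : p ^ (i ℕ.* (m ∸ h)) ℕ.* n ^ i ≡ (p ^ (m ∸ h) ℕ.* n) ^ i
      power = trans (cong (ℕ._* n ^ i)
        (trans (cong (p ^_) (ℕₚ.*-comm i (m ∸ h))) (sym (ℕₚ.^-*-assoc p (m ∸ h) i))))
        (sym (^-distribʳ-* (p ^ (m ∸ h)) n i))
      regroup : ∀ b i q c x → b * (i * q) * c * x ≡ q * (b * i * c * x)
      regroup = solve-∀ ℚ-ring

    statedSum≡ : Σ[ 2 ⋯ m ∸ 1 ] (λ h → Σ[ 1 ⋯ h ] (statedTerm h)) ≡ corrections m n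
    statedSum≡ = trans (Σ≡Sum 2 (m ∸ 1) (λ h → Σ[ 1 ⋯ h ] (statedTerm h)))
      (Sum-cong (suc (m ∸ 1) ∸ 2) λ j _ → let h = 2 ℕ.+ j in
      trans (Σ≡Sum 1 h (statedTerm h)) (trans (Sum-cong h λ k _ → statedTerm≡ h k)
        (Sum-*ˡ (inv (p ^ h)) h (bernoulliTerm (φ h) (p ^ (m ∸ h) ℕ.* n)))))

    conclusion : ν p ≥1 (H (p ^ m ℕ.* n) - (H n ÷ℕ (p ^ m))
      - Σ[ 2 ⋯ m ∸ 1 ] (λ h → Σ[ 1 ⋯ h ] (statedTerm h)))
    conclusion = ord-sound (ord-resp (cong₂ (λ y z → H (p ^ m ℕ.* n) - y - z)
      (sym (÷ℕ≡*inv (H n) (p ^ m))) (sym statedSum≡))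
      (defect≡corrections m n))

open import Data.Nat using (_*_)
open import Data.Rational using (_-_) renaming (_*_ to _*ℚ_)

theorem3p11 : (n m p : ℕ) → Prime p → 5 ≤ p →
    ν p ≥1 (H (p ^ m * n) - (H n ÷ℕ (p ^ m))
    - Σ[ 2 ⋯ m ∸ 1 ] (λ h → Σ[ 1 ⋯ h ] (λ k →
    ((B (p ^ h * (p ∸ 1) ∸ 2 * k) ÷ℕ (2 * k * p ^ h))
    *ℚ ι ((p ^ h * (p ∸ 1) ∸ 1) C (2 * k ∸ 1)))
    *ℚ ι (p ^ (2 * k * (m ∸ h)) * n ^ (2 * k)))))
theorem3p11 n m p p-prime 5≤p = Harmonic.conclusion p p-prime 5≤p n m
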